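{- There is a polynomial-time algorithm that, given a ternary string $s$, computes a shortest sequence of prefix reversals transforming $s$ into its sorted (non-decreasing) rearrangement.
   Context: A ternary string is a finite word over $\{0,1,2\}$. The prefix reversal (flip) $f^{(i)}$ applied to $s=s_1\cdots s_n$ ($1\le i\le n$) yields $s_i s_{i-1}\cdots s_1 s_{i+1}\cdots s_n$. The sorted rearrangement of $s$ is the string with the same symbol multiplicities as $s$ in which all symbols appear in non-decreasing order. -}

module Defs where

open import Data.Fin using (Fin; zero; suc)
open import Data.Fin.Properties using (≤-totalOrder)
import Data.List as List
open import Data.List using (List; []; _∷_; _++_; take; drop; reverse; foldl; concatMap; length)
open import Data.List.Relation.Binary.Permutation.Propositional using (_↭_)
open import Data.List.Relation.Unary.All using (All)
open import Data.List.Relation.Unary.Sorted.TotalOrder (≤-totalOrder 3) using (Sorted)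
open import Data.Maybe using (Maybe; just; nothing)
open import Data.Nat using (ℕ; zero; suc; _+_; _*_; _≤_)
open import Data.Product using (∃; _×_; _,_)
import Data.Vec as Vec
open import Data.Vec using (Vec; []; _∷_; map; zipWith)
open import Function.Bundles using (_↔_)
open import Relation.Binary.PropositionalEquality using (_≡_)

TernaryString : Set
TernaryString = List (Fin 3)

prefixReversal : ℕ → TernaryString → TernaryString
prefixReversal i s = reverse (take i s) ++ drop i s

applyReversals : List ℕ → TernaryString → TernaryString
applyReversals is s = foldl (λ t i → prefixReversal i t) s is

record IsSortedRearrangement (s t : TernaryString) : Set where
  field
    sameMultiplicities : s ↭ t
    nonDecreasing      : Sorted t

-- Prefix reversals preserve length, so the index range 1 … ∣ s ∣ is the same
-- at every step of the sequence.
record IsSortingSequence (s : TernaryString) (is : List ℕ) : Set where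
  field
    inRange : All (λ i → 1 ≤ i × i ≤ length s) is
    sorts   : IsSortedRearrangement s (applyReversals is s)

record IsShortestSortingSequence (s : TernaryString) (is : List ℕ) : Set where
  field
    isSorting : IsSortingSequence s is
    shortest  : ∀ js → IsSortingSequence s js → length is ≤ length js

-- Each index is written in unary (that many 1s), terminated by a 0.  As the
-- indices are at most the length of the string, this is at most polynomially
-- longer than a binary encoding.
encode : List ℕ → List (Fin 3)
encode = concatMap (λ i → List.replicate i (suc zero) ++ zero ∷ [])

data Polynomial : Set where
  const   : ℕ → Polynomial
  var     : Polynomial
  _⊕_ _⊗_ : Polynomial → Polynomial → Polynomial

eval : Polynomial → ℕ → ℕ
eval (const c) n = c
eval var       n = n
eval (p ⊕ q)   n = eval p n + eval q n
eval (p ⊗ q)   n = eval p n * eval q n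

Finite : Set → Set
Finite A = ∃ λ n → A ↔ Fin n

data Symbol (Letter Work : Set) : Set where
  blank  : Symbol Letter Work
  letter : Letter → Symbol Letter Work
  work   : Work → Symbol Letter Work

data Move : Set where
  left stay right : Move

-- A two-way infinite tape: the cell under the head, and the cells on either
-- side of it, nearest first; all cells beyond the two lists are blank.
record Tape (Letter Work : Set) : Set where
  constructor tape
  field
    leftCells  : List (Symbol Letter Work)
    head       : Symbol Letter Work
    rightCells : List (Symbol Letter Work)

module _ {Letter Work : Set} where

  private
    Sym = Symbol Letter Work
    Tp  = Tape Letter Work

  blankTape : Tp
  blankTape = tape [] blank []

  inputTape : List Letter → Tp
  inputTape []      = blankTape
  inputTape (a ∷ w) = tape [] (letter a) (List.map letter w)

  -- The longest word of letters that starts under the head.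
  outputWord : Tp → List Letter
  outputWord (tape _ x r) = prefix (x ∷ r)
    where
    prefix : List Sym → List Letter
    prefix (letter a ∷ xs) = a ∷ prefix xs
    prefix _               = []

  writeAndMove : Sym × Move → Tp → Tp
  writeAndMove (x , stay)  (tape l       _ r)       = tape l x r
  writeAndMove (x , left)  (tape []      _ r)       = tape [] blank (x ∷ r)
  writeAndMove (x , left)  (tape (y ∷ l) _ r)       = tape l y (x ∷ r)
  writeAndMove (x , right) (tape l       _ [])      = tape (x ∷ l) blank []
  writeAndMove (x , right) (tape l       _ (y ∷ r)) = tape (x ∷ l) y r

-- The first tape carries the input, the second one the output; there may be
-- further tapes.  The machine halts where δ is `nothing`.
record TuringMachine (Letter : Set) : Set₁ where
  field
    State       : Set
    finiteState : Finite State
    Work        : Set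
    finiteWork  : Finite Work
    extraTapes  : ℕ
    start       : State

  tapes : ℕ
  tapes = 2 + extraTapes

  field
    δ : State → Vec (Symbol Letter Work) tapes →
        Maybe (State × Vec (Symbol Letter Work × Move) tapes)

  Configuration : Set
  Configuration = State × Vec (Tape Letter Work) tapes

  initial : List Letter → Configuration
  initial w = start , inputTape w ∷ blankTape ∷ Vec.replicate extraTapes blankTape

  output : Configuration → List Letter
  output (_ , _ ∷ t ∷ _) = outputWord t

  step : Configuration → Maybe Configuration
  step (q , ts) with δ q (map Tape.head ts)
  ... | nothing          = nothing
  ... | just (q′ , acts) = just (q′ , zipWith writeAndMove acts ts)

  data HaltsAfter : ℕ → Configuration → Configuration → Set where
    halted : ∀ {c} → step c ≡ nothing → HaltsAfter 0 c c
    next   : ∀ {k c c′ d} → step c ≡ just c′ → HaltsAfter k c′ d → HaltsAfter (suc k) c d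

  OnInput_Outputs_Within_ : List Letter → List Letter → ℕ → Set
  OnInput w Outputs v Within b =
    ∃ λ k → ∃ λ d → HaltsAfter k (initial w) d × output d ≡ v × k ≤ b

{-# OPTIONS --safe #-}

-- The distance of a word s from its sorted rearrangement is blocks s + offset s − 3,
-- where the offset lies between 0 and 3 and is computed by a finite automaton that
-- reads s from right to left.  Write s = ρ ʳ++ v, the prefix to be reversed being
-- stored backwards; the reversal yields ρ ++ v, whose offset is found by a second
-- automaton that starts in a state determined by v and reads ρ.  So two statements
-- about all words can be decided by exploring finitely many states: no reversal
-- lowers the potential blocks + offset by more than one, and some reversal lowers
-- it by one unless the word is sorted.  The Turing machine keeps v and ρ on two
-- tapes and moves the split to the right until it reaches such a reversal, which it
-- performs by pushing the symbols of ρ, deepest first, onto v.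

module Submission where

open import Data.Bool using (Bool; true; false; T; T?; _∧_; _xor_; if_then_else_)
open import Data.Bool.ListAction using (all)
open import Data.Bool.Properties using (T-∧)
open import Data.Empty using (⊥; ⊥-elim)
open import Data.Fin using (Fin; zero; suc; toℕ)
import Data.Fin.Properties as Fin
open import Data.List using (List; []; _∷_; _++_; _∷ʳ_; _ʳ++_; length; foldl; foldr; reverse; map; replicate; deduplicate; cartesianProductWith; head; take; drop; allFin)
open import Data.List.Membership.Propositional using (_∈_)
open import Data.List.Membership.Propositional.Properties using (∈-++⁺ˡ; ∈-++⁺ʳ; ∈-map⁺; ∈-allFin; ∈-cartesianProductWith⁺)
import Data.List.Membership.DecPropositional as DecMembership
import Data.List.Properties as List
open import Data.List.Relation.Binary.Permutation.Propositional using (_↭_; ↭-refl; ↭-sym; ↭-trans; ↭-reflexive)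
import Data.List.Relation.Binary.Permutation.Propositional.Properties as Perm
open import Data.List.Relation.Unary.All using (All; []; _∷_)
import Data.List.Relation.Unary.All as All
import Data.List.Relation.Unary.All.Properties as All
open import Data.List.Relation.Unary.Any using (Any; here; there; any?)
open import Data.List.Relation.Unary.Linked using ([]; [-]; _∷_)
open import Data.List.Relation.Unary.Sorted.TotalOrder (Fin.≤-totalOrder 3) using (Sorted)
open import Data.List.Reverse using (Reverse; reverseView; []; _∶_∶ʳ_)
open import Data.Maybe using (Maybe; just; nothing)
import Data.Maybe as Maybe
import Data.Maybe.Properties as Maybe
open import Data.Nat using (ℕ; zero; suc; _+_; _*_; _≤_; _≤?_; _≤ᵇ_; _≡ᵇ_; _/_; _%_; z≤n; s≤s)
import Data.Nat.Properties as ℕ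
open import Data.Nat.Solver using (module +-*-Solver)
open import Data.Product using (Σ-syntax; ∃-syntax; _×_; _,_; proj₁; proj₂)
open import Data.Product.Function.NonDependent.Propositional using (_×-↔_)
import Data.Product.Properties as Product
open import Data.Sum using (_⊎_; inj₁; inj₂)
open import Data.Sum.Function.Propositional using (_⊎-↔_)
open import Data.Vec using (Vec; []; _∷_; zipWith)
open import Function using (flip)
open import Function.Bundles using (Equivalence; mk↔ₛ′)
open import Function.Construct.Composition using (_↔-∘_)
open import Function.Construct.Identity using (↔-id)
open import Function.Construct.Symmetry using (↔-sym)
open import Relation.Binary using (DecidableEquality)
open import Relation.Binary.PropositionalEquality using (_≡_; refl; sym; trans; cong; cong₂; subst; subst₂; module ≡-Reasoning)
open import Relation.Nullary using (Dec; yes; no; does; _because_; Reflects; ofʸ; ofⁿ)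
open import Relation.Nullary.Decidable using (map′; _×-dec_; toWitness; ⌊_⌋)

open import Defs


-- A reversal changes a single adjacency, the one at the split, so it removes at most one block, and
-- a sorted ternary word has at most 3 of them. The offset corrects the resulting bound, blocks - 3,
-- and gives every sorted word the potential 3 exactly. That finite automata compute this correction
-- is never argued from the combinatorics of words: the tables are data, and what is proved is that
-- certain finite checks on them suffice. Two things have to be arranged for that. The second
-- automaton is just another table, so a third check, `Dual`, has to tie it to the first. And "some
-- reversal is efficient" quantifies over the splits of a word of arbitrary length; a subset
-- construction, `Survey`, carries the states of many splits at once and turns the claim into a
-- property of the single states of one deterministic automaton. Storing ρ backwards lets all
-- automata run on the same input: a letter put in front of s is also the next letter of ρ.

Letter : Set
Letter = Fin 3

private
  variable
    a : Letter
    s u v w : TernaryString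

-- Bit strings as names of states, and binary trees as tables.

Address : ℕ → Set
Address = Vec Bool

-- The least significant bit comes first, matching the split into even and odd positions in
-- `fromList`. A state is thereby the path to its own row.
address : ∀ n → ℕ → Address n
address zero    m = []
address (suc n) m = (m % 2 ≡ᵇ 1) ∷ address n (m / 2)

_==_ : ∀ {n} → Address n → Address n → Bool
[]          == []          = true
(false ∷ b) == (false ∷ c) = b == c
(true  ∷ b) == (true  ∷ c) = b == c
_           == _           = false

==-reflects : ∀ {n} (b c : Address n) → Reflects (b ≡ c) (b == c)
==-reflects []          []          = ofʸ refl
==-reflects (false ∷ b) (true  ∷ c) = ofⁿ λ ()
==-reflects (true  ∷ b) (false ∷ c) = ofⁿ λ ()
==-reflects (false ∷ b) (false ∷ c) with b == c | ==-reflects b c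
... | true  | ofʸ p  = ofʸ (cong (false ∷_) p)
... | false | ofⁿ ¬p = ofⁿ λ { refl → ¬p refl }
==-reflects (true  ∷ b) (true  ∷ c) with b == c | ==-reflects b c
... | true  | ofʸ p  = ofʸ (cong (true ∷_) p)
... | false | ofⁿ ¬p = ofⁿ λ { refl → ¬p refl }

-- The verdict is a plain Boolean computation, kept apart from its evidence, since the explorations
-- evaluate it very often.
_≟ᵃ_ : ∀ {n} → DecidableEquality (Address n)
b ≟ᵃ c = (b == c) because ==-reflects b c

_×-≟_ : ∀ {A B : Set} → DecidableEquality A → DecidableEquality B → DecidableEquality (A × B)
(_≟₁_ ×-≟ _≟₂_) (x , y) (x′ , y′) =
  map′ (λ { (refl , refl) → refl }) Product.,-injective ((x ≟₁ x′) ×-dec (y ≟₂ y′))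

∀-letter? : ∀ {P : Letter → Set} → (∀ a → Dec (P a)) → Dec (∀ a → P a)
∀-letter? P? =
  map′ (λ { (p , q , r) zero → p ; (p , q , r) (suc zero) → q ; (p , q , r) (suc (suc zero)) → r })
       (λ p → p zero , p (suc zero) , p (suc (suc zero)))
       (P? zero ×-dec P? (suc zero) ×-dec P? (suc (suc zero)))

∀-address? : ∀ {n} {P : Address n → Set} → (∀ b → Dec (P b)) → Dec (∀ b → P b)
∀-address? {zero}  P? = map′ (λ { p [] → p }) (λ p → p []) (P? [])
∀-address? {suc n} P? =
  map′ (λ { (p , q) (false ∷ b) → p b ; (p , q) (true ∷ b) → q b })
       (λ p → (λ b → p (false ∷ b)) , (λ b → p (true ∷ b)))
       (∀-address? (λ b → P? (false ∷ b)) ×-dec ∀-address? (λ b → P? (true ∷ b)))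

addresses : ∀ n → List (Address n)
addresses zero    = [] ∷ []
addresses (suc n) = map (false ∷_) (addresses n) ++ map (true ∷_) (addresses n)

∈-addresses : ∀ {n} (b : Address n) → b ∈ addresses n
∈-addresses []          = here refl
∈-addresses (false ∷ b) = ∈-++⁺ˡ (∈-map⁺ (false ∷_) (∈-addresses b))
∈-addresses {suc n} (true  ∷ b) = ∈-++⁺ʳ (map (false ∷_) (addresses n)) (∈-map⁺ (true ∷_) (∈-addresses b))

data Tree (A : Set) : ℕ → Set where
  leaf : A → Tree A 0
  node : ∀ {n} → Tree A n → Tree A n → Tree A (suc n)

module _ {A : Set} where

  lookup : ∀ {n} → Tree A n → Address n → A
  lookup (leaf x)   []          = x
  lookup (node l r) (false ∷ b) = lookup l b
  lookup (node l r) (true  ∷ b) = lookup r b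

  update : ∀ {n} → Address n → (A → A) → Tree A n → Tree A n
  update []          f (leaf x)   = leaf (f x)
  update (false ∷ b) f (node l r) = node (update b f l) r
  update (true  ∷ b) f (node l r) = node l (update b f r)

  evens odds : List A → List A
  evens []       = []
  evens (x ∷ xs) = x ∷ odds xs
  odds []       = []
  odds (x ∷ xs) = evens xs

  fromList : ∀ n → A → List A → Tree A n
  fromList zero    d []      = leaf d
  fromList zero    d (x ∷ _) = leaf x
  fromList (suc n) d xs      = node (fromList n d (evens xs)) (fromList n d (odds xs))

everywhere : ∀ {A : Set} {n} → (A → Bool) → Tree A n → Bool
everywhere p (leaf x)   = p x
everywhere p (node l r) = everywhere p l ∧ everywhere p r

everywhere-lookup : ∀ {A : Set} {n} {p : A → Bool} (t : Tree A n) → T (everywhere p t) → ∀ b → T (p (lookup t b))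
everywhere-lookup (leaf x)   h []          = h
everywhere-lookup (node l r) h (false ∷ b) = everywhere-lookup l (proj₁ (Equivalence.to T-∧ h)) b
everywhere-lookup {p = p} (node l r) h (true ∷ b) =
  everywhere-lookup r (proj₂ (Equivalence.to (T-∧ {everywhere p l}) h)) b

-- Statements about all words, certified by a finite set of states.

module Exploration
  {S : Set} (_≟_ : DecidableEquality S) {n : ℕ} (hash : S → Address n) (step : S → Letter → S)
  where

  open DecMembership _≟_ using (_∈?_)

  Visited : Set
  Visited = Tree (List S) n

  Visits : Visited → S → Set
  Visits t s = s ∈ lookup t (hash s)

  visits? : ∀ t s → Dec (Visits t s)
  visits? t s = s ∈? lookup t (hash s)

  explore : ℕ → List S → Visited → Visited
  explore zero    _        t = t
  explore (suc k) []       t = t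
  explore (suc k) (s ∷ ss) t with visits? t s
  ... | yes _ = explore k ss t
  ... | no  _ = explore k (map (step s) (allFin 3) ++ ss) (update (hash s) (s ∷_) t)

  -- Nothing depends on the fuel being sufficient: `closed` is tested afterwards.
  reachableFrom : List S → Visited
  reachableFrom ss = explore 1000000 ss (fromList n [] [])

  module _ {P : S → Set} (P? : ∀ s → Dec (P s)) where

    accepts : Visited → S → Bool
    accepts t s = ⌊ P? s ×-dec ∀-letter? (λ a → visits? t (step s a)) ⌋

    closed : List S → Visited → Bool
    closed ss t = all (λ s → ⌊ visits? t s ⌋) ss ∧ everywhere (all (accepts t)) t

    -- A record rather than the bare `T (closed ss t)`, so that comparing types does not unfold the
    -- exploration and `ss` and `t` can be read off the type.
    record Certificate (ss : List S) (t : Visited) : Set where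
      constructor certificate
      field
        checked : T (closed ss t)

    certificate? : ∀ ss t → Dec (Certificate ss t)
    certificate? ss t = map′ certificate Certificate.checked (T? (closed ss t))

    -- A closed set is an inductive invariant, whatever procedure produced it. Hence no property of
    -- `explore` has to be proved.
    certified : ∀ ss t → Certificate ss t → ∀ {s} → s ∈ ss → ∀ w → P (foldl step s w)
    certified ss t (certificate c) s∈ss = go (toWitness (All.lookup (All.all⁺ _ ss starts) s∈ss))
      where
      starts = proj₁ (Equivalence.to T-∧ c)
      inside = proj₂ (Equivalence.to (T-∧ {all (λ s → ⌊ visits? t s ⌋) ss}) c)

      accepted : ∀ {s} → Visits t s → P s × ∀ a → Visits t (step s a)
      accepted {s} v = toWitness (All.lookup (All.all⁺ _ (lookup t (hash s)) (everywhere-lookup t inside (hash s))) v)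

      go : ∀ {s} → Visits t s → ∀ w → P (foldl step s w)
      go v []      = proj₁ (accepted v)
      go v (a ∷ w) = go (proj₂ (accepted v) a) w

-- Automata

-- A `Suffix` is the state reached on a word v read from right to left, a `Prefix`
-- stands for the function ρ ↦ offset (ρ ++ v).
Suffix Prefix : Set
Suffix = Address 8
Prefix = Address 11

data SuffixRow : Set where
  row : Suffix → Suffix → Suffix → Maybe Letter → Prefix → SuffixRow

data PrefixRow : Set where
  row : Prefix → Prefix → Prefix → ℕ → PrefixRow

choose : {A : Set} → A → A → A → Letter → A
choose x y z zero             = x
choose x y z (suc zero)       = y
choose x y z (suc (suc zero)) = z

-- Here `nothing` is the end of the word. It differs from every letter, so the last block is counted
-- too, and a split at the end of the word leaves the blocks intact.
change : Maybe Letter → Maybe Letter → Fin 2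
change x y = if does (Maybe.≡-dec Fin._≟_ x y) then zero else suc zero

module Automata (suffixes : Tree SuffixRow 8) (prefixes : Tree PrefixRow 11) where

  root : Suffix
  root = address 8 0

  prepend : Letter → Suffix → Suffix
  prepend a l with lookup suffixes l
  ... | row x y z _ _ = choose x y z a

  first : Suffix → Maybe Letter
  first l with lookup suffixes l
  ... | row _ _ _ f _ = f

  insertion : Suffix → Prefix
  insertion l with lookup suffixes l
  ... | row _ _ _ _ c = c

  append : Prefix → Letter → Prefix
  append c a with lookup prefixes c
  ... | row x y z _ = choose x y z a

  out : Prefix → ℕ
  out c with lookup prefixes c
  ... | row _ _ _ n = n

  -- The insertion state of v stands for ρ ↦ offset (ρ ++ v); this is its value at the empty ρ.
  offset : Suffix → ℕ
  offset l = out (insertion l)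

  -- Two ways to follow ρ ∷ʳ b ++ v: with v as the rest, b being read last, and with
  -- b ∷ v as the rest.
  Twin : Set
  Twin = Prefix × Prefix × Letter

  twin : Suffix → Letter → Twin
  twin l b = insertion l , insertion (prepend b l) , b

  stepTwin : Twin → Letter → Twin
  stepTwin (c , d , b) a = append c a , append d a , b

  Dual : Twin → Set
  Dual (c , d , b) = out (append c b) ≡ out d

  -- For s = (a ∷ ρ) ʳ++ v: the states of s and of a ∷ ρ ++ v, the first letter of v,
  -- and whether a differs from it, i.e. whether the split leaves the blocks intact.
  Track : Set
  Track = Suffix × Prefix × Maybe Letter × Fin 2

  enter : Suffix → Letter → Track
  enter l a = prepend a l , append (insertion l) a , first l , change (just a) (first l)

  -- Lengthening ρ puts a letter in front of s and the same letter at the end of the reversed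
  -- prefix, so one input letter drives both components. The last two components belong to the split
  -- and stay.
  extend : Track → Letter → Track
  extend (l , c , f , k) a = prepend a l , append c a , f , k

  -- The potentials of the word before and after the reversal, without the summands they share: only
  -- the adjacency at the split differs. In `after`, `first l` is the first letter of s, which the
  -- reversal brings next to v.
  before after : Track → ℕ
  before (l , _ , _ , k) = offset l + toℕ k
  after  (l , c , f , _) = out c + toℕ (change (first l) f)

  Bounded Efficient : Track → Set
  Bounded   t = before t ≤ suc (after t)
  Efficient t = before t ≡ suc (after t)

  Site : Set
  Site = Prefix × Maybe Letter

  -- The state of the word, its number of blocks if it is sorted, and all its splits
  -- that leave the blocks intact.
  Survey : Set
  Survey = Suffix × Maybe ℕ × List Site

  -- The last component is `suc zero` because `newSites` opens a site only where `change` has this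
  -- value.
  track : Suffix → Site → Track
  track l (c , f) = l , c , f , suc zero

  _≟ˢ_ : DecidableEquality Site
  _≟ˢ_ = _≟ᵃ_ ×-≟ Maybe.≡-dec Fin._≟_

  extendSite : Letter → Site → Site
  extendSite a (c , f) = append c a , f

  newSites : Letter → Suffix → Fin 2 → List Site
  newSites a l zero       = []
  newSites a l (suc zero) = (append (insertion l) a , first l) ∷ []

  ascend : Letter → Maybe Letter → Maybe ℕ → Maybe ℕ
  ascend a nothing  m = Maybe.map suc m
  ascend a (just b) m =
    if toℕ a ≤ᵇ toℕ b then Maybe.map (toℕ (change (just a) (just b)) +_) m else nothing

  survey : Survey → Letter → Survey
  survey (l , m , sites) a =
    prepend a l , ascend a (first l) m ,
    -- Without repetitions, only finitely many lists of sites can occur. The block count is bounded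
    -- as well, since it is kept for sorted words only.
    deduplicate _≟ˢ_ (map (extendSite a) sites ++ newSites a l (change (just a) (first l)))

  Progress : Survey → Set
  Progress (l , just n  , _)     = n + offset l ≡ 3
  Progress (l , nothing , sites) = Any (λ e → Efficient (track l e)) sites

  Consistent : Suffix → Set
  Consistent l = offset l ≤ 3 × ∀ a → first (prepend a l) ≡ just a

  consistent? : ∀ l → Dec (Consistent l)
  consistent? l = (offset l ≤? 3) ×-dec ∀-letter? (λ a → Maybe.≡-dec Fin._≟_ (first (prepend a l)) (just a))

  dual? : ∀ t → Dec (Dual t)
  dual? (c , d , b) = out (append c b) ℕ.≟ out d

  bounded? : ∀ t → Dec (Bounded t)
  bounded? t = before t ≤? suc (after t)

  efficient? : ∀ t → Dec (Efficient t)
  efficient? t = before t ℕ.≟ suc (after t)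

  progress? : ∀ s → Dec (Progress s)
  progress? (l , just n  , _)     = (n + offset l) ℕ.≟ 3
  progress? (l , nothing , sites) = any? (λ e → efficient? (track l e)) sites

  -- The three hash functions only choose buckets. They influence the cost of a look-up, not what is
  -- certified.
  hashTwin : Twin → Address 11
  hashTwin (c , _) = c

  hashTrack : Track → Address 11
  hashTrack (l , c , _) = zipWith _xor_ c (false ∷ false ∷ false ∷ l)

  hashSurvey : Survey → Address 11
  hashSurvey (_ , _ , sites) = foldr (λ e → zipWith _xor_ (proj₁ e)) (address 11 0) sites

  _≟ᵗ_ : DecidableEquality Twin
  _≟ᵗ_ = _≟ᵃ_ ×-≟ (_≟ᵃ_ ×-≟ Fin._≟_)

  _≟ᵏ_ : DecidableEquality Track
  _≟ᵏ_ = _≟ᵃ_ ×-≟ (_≟ᵃ_ ×-≟ (Maybe.≡-dec Fin._≟_ ×-≟ Fin._≟_))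

  _≟ᵛ_ : DecidableEquality Survey
  _≟ᵛ_ = _≟ᵃ_ ×-≟ (Maybe.≡-dec ℕ._≟_ ×-≟ List.≡-dec _≟ˢ_)

  module Twins = Exploration _≟ᵗ_ hashTwin stepTwin
  module Tracks = Exploration _≟ᵏ_ hashTrack extend
  module Surveys = Exploration _≟ᵛ_ hashSurvey survey

  -- Every address is a start, here and in `tracks`, so that `dual` and `bounded` hold for an
  -- arbitrary state of v, and only ρ is explored letter by letter.
  twins : List Twin
  twins = cartesianProductWith twin (addresses 8) (allFin 3)

  tracks : List Track
  tracks = cartesianProductWith enter (addresses 8) (allFin 3)

  unsurveyed : Survey
  unsurveyed = root , just 0 , []

  record Valid : Set where
    field
      first-root : first root ≡ nothing
      consistent : ∀ l → Consistent l
      duals      : Twins.Certificate dual? twins (Twins.reachableFrom twins)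
      bounds     : Tracks.Certificate bounded? tracks (Tracks.reachableFrom tracks)
      progresses : Surveys.Certificate progress? (unsurveyed ∷ []) (Surveys.reachableFrom (unsurveyed ∷ []))

    dual : ∀ l b w → Dual (foldl stepTwin (twin l b) w)
    dual l b = Twins.certified dual? twins (Twins.reachableFrom twins) duals
      (∈-cartesianProductWith⁺ twin (∈-addresses l) (∈-allFin b))

    bounded : ∀ l a w → Bounded (foldl extend (enter l a) w)
    bounded l a = Tracks.certified bounded? tracks (Tracks.reachableFrom tracks) bounds
      (∈-cartesianProductWith⁺ enter (∈-addresses l) (∈-allFin a))

    progress : ∀ w → Progress (foldl survey unsurveyed w)
    progress = Surveys.certified progress? (unsurveyed ∷ []) (Surveys.reachableFrom (unsurveyed ∷ []))
      progresses (here refl)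

  -- Decided here, and not for the tables below, so that evaluation shares the tables.
  valid? : Dec Valid
  valid? = map′
    (λ { (r , c , d , b , p) → record { first-root = r ; consistent = c ; duals = d ; bounds = b ; progresses = p } })
    (λ V → let open Valid V in first-root , consistent , duals , bounds , progresses)
    (Maybe.≡-dec Fin._≟_ (first root) nothing ×-dec
     ∀-address? consistent? ×-dec
     Twins.certificate? dual? twins (Twins.reachableFrom twins) ×-dec
     Tracks.certificate? bounded? tracks (Tracks.reachableFrom tracks) ×-dec
     Surveys.certificate? progress? (unsurveyed ∷ []) (Surveys.reachableFrom (unsurveyed ∷ [])))

  suffix : TernaryString → Suffix
  suffix = foldr prepend root

  trackAt : Letter → TernaryString → TernaryString → Track
  trackAt a ρ v = foldl extend (enter (suffix v) a) ρ

  Good : TernaryString → TernaryString → Set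
  -- An empty prefix is no reversal, as indices start at 1.
  Good []      v = ⊥
  Good (a ∷ ρ) v = Efficient (trackAt a ρ v)

  good? : ∀ ρ v → Dec (Good ρ v)
  good? []      v = no λ ()
  good? (a ∷ ρ) v = efficient? (trackAt a ρ v)

-- The potential of a word

regroup : ∀ j x b o → j + (x + b) + o ≡ j + b + (o + x)
regroup j x b o = begin
  j + (x + b) + o    ≡⟨ cong (λ m → j + m + o) (ℕ.+-comm x b) ⟩
  j + (b + x) + o    ≡⟨ cong (_+ o) (ℕ.+-assoc j b x) ⟨
  j + b + x + o      ≡⟨ ℕ.+-assoc (j + b) x o ⟩
  j + b + (x + o)    ≡⟨ cong (j + b +_) (ℕ.+-comm x o) ⟩
  j + b + (o + x)    ∎
  where open ≡-Reasoning

change-sym : ∀ x y → change x y ≡ change y x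
change-sym x y with Maybe.≡-dec Fin._≟_ x y | Maybe.≡-dec Fin._≟_ y x
... | yes _   | yes _   = refl
... | no _    | no _    = refl
... | yes x≡y | no y≢x  = ⊥-elim (y≢x (sym x≡y))
... | no x≢y  | yes y≡x = ⊥-elim (x≢y (sym y≡x))

blocks : TernaryString → ℕ
blocks []      = 0
blocks (a ∷ s) = toℕ (change (just a) (head s)) + blocks s

jumps : Letter → TernaryString → ℕ
jumps a []      = 0
jumps a (b ∷ s) = toℕ (change (just a) (just b)) + jumps b s

final : Letter → TernaryString → Letter
final a []      = a
final a (b ∷ s) = final b s

head-ʳ++ : ∀ a ρ v → head (ρ ʳ++ (a ∷ v)) ≡ just (final a ρ)
head-ʳ++ a []      v = refl
head-ʳ++ a (b ∷ ρ) v = head-ʳ++ b ρ (a ∷ v)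

-- Since `change` is symmetric, the adjacencies inside the prefix contribute the same `jumps a ρ`
-- here and, after the reversal, in `blocks-++`.
blocks-ʳ++ : ∀ a ρ v → blocks (ρ ʳ++ (a ∷ v)) ≡ jumps a ρ + blocks (a ∷ v)
blocks-ʳ++ a []      v = refl
blocks-ʳ++ a (b ∷ ρ) v = begin
  blocks (ρ ʳ++ (b ∷ a ∷ v))
    ≡⟨ blocks-ʳ++ b ρ (a ∷ v) ⟩
  jumps b ρ + (toℕ (change (just b) (just a)) + blocks (a ∷ v))
    ≡⟨ ℕ.+-assoc (jumps b ρ) _ _ ⟨
  jumps b ρ + toℕ (change (just b) (just a)) + blocks (a ∷ v)
    ≡⟨ cong (_+ blocks (a ∷ v)) (ℕ.+-comm (jumps b ρ) _) ⟩
  toℕ (change (just b) (just a)) + jumps b ρ + blocks (a ∷ v)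
    ≡⟨ cong (λ k → toℕ k + jumps b ρ + blocks (a ∷ v)) (change-sym (just b) (just a)) ⟩
  toℕ (change (just a) (just b)) + jumps b ρ + blocks (a ∷ v) ∎
  where open ≡-Reasoning

blocks-++ : ∀ a ρ v → blocks (a ∷ ρ ++ v) ≡ jumps a ρ + (toℕ (change (just (final a ρ)) (head v)) + blocks v)
blocks-++ a []      v = refl
blocks-++ a (b ∷ ρ) v = trans
  (cong (toℕ (change (just a) (just b)) +_) (blocks-++ b ρ v))
  (sym (ℕ.+-assoc (toℕ (change (just a) (just b))) (jumps b ρ) _))

∷ʳ-ʳ++ : ∀ ρ (a : Letter) v → (ρ ∷ʳ a) ʳ++ v ≡ a ∷ (ρ ʳ++ v)
∷ʳ-ʳ++ ρ a v = List.++-ʳ++ ρ {a ∷ []} {v}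

take-length-++ : ∀ (u v : TernaryString) → take (length u) (u ++ v) ≡ u
take-length-++ []      v = refl
take-length-++ (a ∷ u) v = cong (a ∷_) (take-length-++ u v)

drop-length-++ : ∀ (u v : TernaryString) → drop (length u) (u ++ v) ≡ v
drop-length-++ []      v = refl
drop-length-++ (a ∷ u) v = drop-length-++ u v

prefixReversal-ʳ++ : ∀ ρ v → prefixReversal (length ρ) (ρ ʳ++ v) ≡ ρ ++ v
prefixReversal-ʳ++ ρ v = begin
  prefixReversal (length ρ) (ρ ʳ++ v)
    ≡⟨ cong₂ prefixReversal (sym (List.length-reverse ρ)) (List.ʳ++-defn ρ) ⟩
  prefixReversal (length (reverse ρ)) (reverse ρ ++ v)
    ≡⟨ cong₂ (λ x y → reverse x ++ y) (take-length-++ (reverse ρ) v) (drop-length-++ (reverse ρ) v) ⟩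
  reverse (reverse ρ) ++ v
    ≡⟨ cong (_++ v) (List.reverse-involutive ρ) ⟩
  ρ ++ v ∎
  where open ≡-Reasoning

reverse-ʳ++ : ∀ (u v : TernaryString) → reverse u ʳ++ v ≡ u ++ v
reverse-ʳ++ u v = trans (List.ʳ++-defn (reverse u)) (cong (_++ v) (List.reverse-involutive u))

reverse-ʳ++-[] : ∀ (u : TernaryString) → reverse u ʳ++ [] ≡ u
reverse-ʳ++-[] u = trans (reverse-ʳ++ u []) (List.++-identityʳ u)

reverse-take-ʳ++ : ∀ i (s : TernaryString) → reverse (take i s) ʳ++ drop i s ≡ s
reverse-take-ʳ++ i s = trans (reverse-ʳ++ (take i s) (drop i s)) (List.take++drop≡id i s)

prefixReversal-↭ : ∀ i s → s ↭ prefixReversal i s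
prefixReversal-↭ i s =
  ↭-trans (↭-reflexive (sym (List.take++drop≡id i s)))
          (Perm.++⁺ʳ (drop i s) (↭-sym (Perm.↭-reverse (take i s))))

length-prefixReversal : ∀ i s → length (prefixReversal i s) ≡ length s
length-prefixReversal i s = sym (Perm.↭-length (prefixReversal-↭ i s))

isSortingSequence-∷ : ∀ ρ v {is} → 1 ≤ length ρ →
                      IsSortingSequence (ρ ++ v) is → IsSortingSequence (ρ ʳ++ v) (length ρ ∷ is)
isSortingSequence-∷ ρ v {is} 1≤ρ S = record
  { inRange = (1≤ρ , subst (length ρ ≤_) (sym (List.length-ʳ++ ρ)) (ℕ.m≤m+n _ _))
            ∷ subst (λ n → All (λ i → 1 ≤ i × i ≤ n) is)
                    (trans (List.length-++ ρ) (sym (List.length-ʳ++ ρ))) inRange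
  ; sorts   = record
    { sameMultiplicities = ↭-trans (prefixReversal-↭ (length ρ) (ρ ʳ++ v))
        (subst (λ t → t ↭ applyReversals is t) (sym reversed) sameMultiplicities)
    ; nonDecreasing      = subst (λ t → Sorted (applyReversals is t)) (sym reversed) nonDecreasing
    }
  }
  where
  open IsSortingSequence S
  open IsSortedRearrangement sorts
  reversed = prefixReversal-ʳ++ ρ v

-- The effect of reversals on the potential, and the lower bound for sorting sequences.

module Potential
  (suffixes : Tree SuffixRow 8) (prefixes : Tree PrefixRow 11)
  (valid : Automata.Valid suffixes prefixes)
  where

  open Automata suffixes prefixes
  open Valid valid

  potential : TernaryString → ℕ
  potential s = blocks s + offset (suffix s)

  first-suffix : ∀ s → first (suffix s) ≡ head s
  first-suffix []      = first-root
  first-suffix (a ∷ s) = proj₂ (consistent (suffix s)) a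

  foldl-stepTwin : ∀ c d b w → foldl stepTwin (c , d , b) w ≡ (foldl append c w , foldl append d w , b)
  foldl-stepTwin c d b []      = refl
  foldl-stepTwin c d b (a ∷ w) = foldl-stepTwin (append c a) (append d a) b w

  foldl-extend : ∀ l c f k w → foldl extend (l , c , f , k) w ≡ (foldl (flip prepend) l w , foldl append c w , f , k)
  foldl-extend l c f k []      = refl
  foldl-extend l c f k (a ∷ w) = foldl-extend (prepend a l) (append c a) f k w

  foldl-prepend : ∀ ρ v → foldl (flip prepend) (suffix v) ρ ≡ suffix (ρ ʳ++ v)
  foldl-prepend []      v = refl
  foldl-prepend (a ∷ ρ) v = foldl-prepend ρ (a ∷ v)

  -- The letters of ρ pass one at a time from the end of what the second automaton reads to the
  -- front of the rest. `Dual` is a single such move, which is why the induction takes ρ from its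
  -- right end.
  duality : ∀ l {ρ} → Reverse ρ → out (foldl append (insertion l) ρ) ≡ offset (foldr prepend l ρ)
  duality l []            = refl
  duality l (ρ ∶ r ∶ʳ b) = begin
    out (foldl append (insertion l) (ρ ∷ʳ b))
      ≡⟨ cong out (List.foldl-∷ʳ append (insertion l) b ρ) ⟩
    out (append (foldl append (insertion l) ρ) b)
      ≡⟨ subst Dual (foldl-stepTwin (insertion l) (insertion (prepend b l)) b ρ) (dual l b ρ) ⟩
    out (foldl append (insertion (prepend b l)) ρ)
      ≡⟨ duality (prepend b l) r ⟩
    offset (foldr prepend (prepend b l) ρ)
      ≡⟨ cong offset (List.foldr-∷ʳ prepend l b ρ) ⟨
    offset (foldr prepend l (ρ ∷ʳ b)) ∎
    where open ≡-Reasoning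

  out-insertion : ∀ ρ v → out (foldl append (insertion (suffix v)) ρ) ≡ offset (suffix (ρ ++ v))
  out-insertion ρ v = trans (duality (suffix v) (reverseView ρ)) (cong offset (sym (List.foldr-++ prepend root ρ v)))

  trackAt-≡ : ∀ a ρ v → trackAt a ρ v ≡
    (suffix ((a ∷ ρ) ʳ++ v) , foldl append (insertion (suffix v)) (a ∷ ρ) ,
     first (suffix v) , change (just a) (first (suffix v)))
  trackAt-≡ a ρ v = trans
    (foldl-extend (prepend a (suffix v)) _ _ _ ρ)
    (cong (λ l → l , foldl append (insertion (suffix v)) (a ∷ ρ) ,
                 first (suffix v) , change (just a) (first (suffix v)))
          (foldl-prepend ρ (a ∷ v)))

  module _ (a : Letter) (ρ v : TernaryString) where

    private
      x = toℕ (change (just a) (head v))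
      y = toℕ (change (just (final a ρ)) (head v))

    before-trackAt : before (trackAt a ρ v) ≡ offset (suffix ((a ∷ ρ) ʳ++ v)) + x
    before-trackAt = trans
      (cong before (trackAt-≡ a ρ v))
      (cong (λ f → offset (suffix ((a ∷ ρ) ʳ++ v)) + toℕ (change (just a) f)) (first-suffix v))

    after-trackAt : after (trackAt a ρ v) ≡ offset (suffix (a ∷ ρ ++ v)) + y
    after-trackAt = trans
      (cong after (trackAt-≡ a ρ v))
      (cong₂ _+_ (out-insertion (a ∷ ρ) v)
        (cong₂ (λ f g → toℕ (change f g))
          (trans (first-suffix (ρ ʳ++ (a ∷ v))) (head-ʳ++ a ρ v))
          (first-suffix v)))

    potential-before : potential ((a ∷ ρ) ʳ++ v) ≡ (jumps a ρ + blocks v) + before (trackAt a ρ v)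
    potential-before = trans
      (cong (_+ offset (suffix ((a ∷ ρ) ʳ++ v))) (blocks-ʳ++ a ρ v))
      (trans (regroup (jumps a ρ) x (blocks v) (offset (suffix ((a ∷ ρ) ʳ++ v))))
             (cong (jumps a ρ + blocks v +_) (sym before-trackAt)))

    potential-after : potential (a ∷ ρ ++ v) ≡ (jumps a ρ + blocks v) + after (trackAt a ρ v)
    potential-after = trans
      (cong (_+ offset (suffix (a ∷ ρ ++ v))) (blocks-++ a ρ v))
      (trans (regroup (jumps a ρ) y (blocks v) (offset (suffix (a ∷ ρ ++ v))))
             (cong (jumps a ρ + blocks v +_) (sym after-trackAt)))

    potential-drops : potential ((a ∷ ρ) ʳ++ v) ≤ suc (potential (a ∷ ρ ++ v))
    potential-drops = begin
      potential ((a ∷ ρ) ʳ++ v)                            ≡⟨ potential-before ⟩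
      jumps a ρ + blocks v + before (trackAt a ρ v)
        ≤⟨ ℕ.+-monoʳ-≤ (jumps a ρ + blocks v) (bounded (suffix v) a ρ) ⟩
      jumps a ρ + blocks v + suc (after (trackAt a ρ v))   ≡⟨ ℕ.+-suc _ _ ⟩
      suc (jumps a ρ + blocks v + after (trackAt a ρ v))   ≡⟨ cong suc potential-after ⟨
      suc (potential (a ∷ ρ ++ v))                         ∎
      where open ℕ.≤-Reasoning

    efficient-drops : Efficient (trackAt a ρ v) → potential ((a ∷ ρ) ʳ++ v) ≡ suc (potential (a ∷ ρ ++ v))
    efficient-drops e = begin
      potential ((a ∷ ρ) ʳ++ v)                            ≡⟨ potential-before ⟩
      jumps a ρ + blocks v + before (trackAt a ρ v)        ≡⟨ cong (jumps a ρ + blocks v +_) e ⟩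
      jumps a ρ + blocks v + suc (after (trackAt a ρ v))   ≡⟨ ℕ.+-suc _ _ ⟩
      suc (jumps a ρ + blocks v + after (trackAt a ρ v))   ≡⟨ cong suc potential-after ⟨
      suc (potential (a ∷ ρ ++ v))                         ∎
      where open ≡-Reasoning

  potential-ʳ++ : ∀ ρ v → 1 ≤ length ρ → potential (ρ ʳ++ v) ≤ suc (potential (ρ ++ v))
  potential-ʳ++ (a ∷ ρ) v _ = potential-drops a ρ v

  potential-prefixReversal : ∀ i s → 1 ≤ i → i ≤ length s → potential s ≤ suc (potential (prefixReversal i s))
  potential-prefixReversal i s 1≤i i≤n =
    subst (λ t → potential t ≤ suc (potential (prefixReversal i s))) (reverse-take-ʳ++ i s)
          (potential-ʳ++ (reverse (take i s)) (drop i s) 1≤ρ)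
    where
    1≤ρ : 1 ≤ length (reverse (take i s))
    1≤ρ = subst (1 ≤_)
      (sym (trans (List.length-reverse (take i s)) (trans (List.length-take i s) (ℕ.m≤n⇒m⊓n≡m i≤n)))) 1≤i

  -- A good split lies at the present position or further right. This excludes that the machine
  -- reaches the end of an unsorted word without having found one.
  data Search : TernaryString → TernaryString → Set where
    found : ∀ {ρ v} → Good ρ v → Search ρ v
    later : ∀ {ρ a v} → Search (a ∷ ρ) v → Search ρ (a ∷ v)

  search-from-start : ∀ ρ {v} → Search ρ v → Search [] (ρ ʳ++ v)
  search-from-start []      p = p
  search-from-start (a ∷ ρ) p = search-from-start ρ (later p)

  ascending : TernaryString → Maybe ℕ
  ascending []      = just 0
  ascending (a ∷ s) = ascend a (head s) (ascending s)

  -- A `Site` remembers only a state and a letter; this supplies an actual split of s behind them,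
  -- from which a `Search` can be built.
  IsSite : TernaryString → Site → Set
  IsSite s (c , f) = ∃[ a ] ∃[ ρ ] ∃[ v ]
    (a ∷ ρ) ʳ++ v ≡ s × foldl append (insertion (suffix v)) (a ∷ ρ) ≡ c ×
    first (suffix v) ≡ f × change (just a) (first (suffix v)) ≡ suc zero

  isSite-∷ : ∀ b {s e} → IsSite s e → IsSite (b ∷ s) (extendSite b e)
  isSite-∷ b (a , ρ , v , refl , refl , refl , new) =
    a , ρ ∷ʳ b , v , ∷ʳ-ʳ++ (a ∷ ρ) b v , List.foldl-∷ʳ append (insertion (suffix v)) b (a ∷ ρ) , refl , new

  newSites-sound : ∀ a s → All (IsSite (a ∷ s)) (newSites a (suffix s) (change (just a) (first (suffix s))))
  newSites-sound a s with change (just a) (first (suffix s)) in eq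
  ... | zero     = []
  ... | suc zero = (a , [] , s , refl , refl , refl , eq) ∷ []

  surveyed : TernaryString → Survey
  surveyed = foldr (flip survey) unsurveyed

  Sound : TernaryString → Survey → Set
  Sound s (l , m , sites) = l ≡ suffix s × m ≡ ascending s × All (IsSite s) sites

  surveyed-sound : ∀ s → Sound s (surveyed s)
  surveyed-sound []      = refl , refl , []
  surveyed-sound (a ∷ s) with surveyed s | surveyed-sound s
  ... | l , m , sites | refl , refl , sound =
    refl , cong (λ f → ascend a f (ascending s)) (first-suffix s) ,
    All.deduplicate⁺ _≟ˢ_ (All.++⁺ (All.map⁺ (All.map (isSite-∷ a) sound)) (newSites-sound a s))

  progress-surveyed : ∀ s → Progress (surveyed s)
  -- The certificate speaks of `foldl`, whereas a survey reads s from right to left; hence the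
  -- reversed word.
  progress-surveyed s = subst Progress (List.reverse-foldl survey unsurveyed s) (progress (reverse s))

  ascending-sorted : ∀ s {n} → ascending s ≡ just n → Sorted s
  ascending-sorted []          eq = []
  ascending-sorted (a ∷ [])    eq = [-]
  ascending-sorted (a ∷ b ∷ s) eq with toℕ a ≤ᵇ toℕ b in a≤b | ascending (b ∷ s) | ascending-sorted (b ∷ s)
  ... | true | just m | sorted = ℕ.≤ᵇ⇒≤ (toℕ a) (toℕ b) (subst T (sym a≤b) _) ∷ sorted refl
  ascending-sorted (a ∷ b ∷ s) () | true  | nothing | _
  ascending-sorted (a ∷ b ∷ s) () | false | _       | _

  sorted-ascending : Sorted s → ascending s ≡ just (blocks s)
  sorted-ascending [] = refl
  sorted-ascending [-] = refl
  sorted-ascending {a ∷ b ∷ s} (a≤b ∷ sorted) with toℕ a ≤ᵇ toℕ b | ℕ.≤⇒≤ᵇ a≤b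
  ... | true | _ = cong (Maybe.map (toℕ (change (just a) (just b)) +_)) (sorted-ascending sorted)

  potential-sorted : Sorted s → potential s ≡ 3
  potential-sorted {s} sorted with surveyed s | surveyed-sound s | progress-surveyed s
  ... | l , m , sites | refl , refl , _ | p rewrite sorted-ascending sorted = p

  site-search : ∀ {l e} → l ≡ suffix s → IsSite s e → Efficient (track l e) → Search [] s
  site-search refl (a , ρ , v , refl , refl , refl , new) e = search-from-start (a ∷ ρ) (found good)
    where
    good : Efficient (trackAt a ρ v)
    good = subst Efficient (sym (trans (trackAt-≡ a ρ v)
      (cong (λ k → suffix ((a ∷ ρ) ʳ++ v) , foldl append (insertion (suffix v)) (a ∷ ρ) , first (suffix v) , k)
            new))) e

  sites-search : ∀ {l sites} → l ≡ suffix s → All (IsSite s) sites →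
                 Any (λ e → Efficient (track l e)) sites → Search [] s
  sites-search l≡ (i ∷ _)  (here e)  = site-search l≡ i e
  sites-search l≡ (_ ∷ is) (there p) = sites-search l≡ is p

  sorted⊎search : ∀ s → Sorted s ⊎ Search [] s
  sorted⊎search s with surveyed s | surveyed-sound s | progress-surveyed s
  ... | l , just n  , sites | _ , m≡ , _         | _ = inj₁ (ascending-sorted s (sym m≡))
  ... | l , nothing , sites | l≡ , _ , sound | p = inj₂ (sites-search l≡ sound p)

  change≤1 : ∀ x y → toℕ (change x y) ≤ 1
  change≤1 x y = ℕ.≤-pred (Fin.toℕ<n (change x y))

  blocks≤length : ∀ s → blocks s ≤ length s
  blocks≤length []      = z≤n
  blocks≤length (a ∷ s) = ℕ.+-mono-≤ (change≤1 (just a) (head s)) (blocks≤length s)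

  potential≤ : ∀ s → potential s ≤ length s + 3
  potential≤ s = ℕ.+-mono-≤ (blocks≤length s) (proj₁ (consistent (suffix s)))

  -- Each reversal lowers the potential by at most one, and all sorted words share the potential 3,
  -- so the end of every sorting sequence is at the same level.
  lowerBound : ∀ s js → IsSortingSequence s js → potential s ≤ length js + 3
  lowerBound s [] p = ℕ.≤-reflexive (potential-sorted (IsSortedRearrangement.nonDecreasing (IsSortingSequence.sorts p)))
  lowerBound s (j ∷ js) p with IsSortingSequence.inRange p
  ... | (1≤j , j≤n) ∷ rs =
    ℕ.≤-trans (potential-prefixReversal j s 1≤j j≤n) (s≤s (lowerBound (prefixReversal j s) js record
      { inRange = subst (λ n → All (λ i → 1 ≤ i × i ≤ n) js) (sym (length-prefixReversal j s)) rs
      ; sorts   = record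
        { sameMultiplicities = ↭-trans (↭-sym (prefixReversal-↭ j s)) sameMultiplicities
        ; nonDecreasing      = nonDecreasing
        }
      }))
    where open IsSortedRearrangement (IsSortingSequence.sorts p)

-- Finiteness of the sets of machine states.

finite-× : ∀ {A B} → Finite A → Finite B → Finite (A × B)
finite-× (m , f) (n , g) = m * n , ↔-sym (Fin.*↔×) ↔-∘ (f ×-↔ g)

finite-⊎ : ∀ {A B} → Finite A → Finite B → Finite (A ⊎ B)
finite-⊎ (m , f) (n , g) = m + n , ↔-sym (Fin.+↔⊎) ↔-∘ (f ⊎-↔ g)

finite-Fin : ∀ n → Finite (Fin n)
finite-Fin n = n , ↔-id (Fin n)

finite-Address : ∀ n → Finite (Address n)
finite-Address zero    = 1 , mk↔ₛ′ (λ _ → zero) (λ _ → []) (λ { zero → refl }) (λ { [] → refl })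
finite-Address (suc n) with finite-× (2 , ↔-sym Fin.2↔Bool) (finite-Address n)
... | m , f = m , f ↔-∘ mk↔ₛ′ split join (λ _ → refl) (λ { (x ∷ b) → refl })
  where
  split : Address (suc n) → Bool × Address n
  split (x ∷ b) = x , b
  join : Bool × Address n → Address (suc n)
  join (x , b) = x ∷ b

finite-Maybe-Fin : ∀ n → Finite (Maybe (Fin n))
finite-Maybe-Fin n = suc n , mk↔ₛ′
  (λ { nothing → zero ; (just i) → suc i }) (λ { zero → nothing ; (suc i) → just i })
  (λ { zero → refl ; (suc i) → refl }) (λ { nothing → refl ; (just i) → refl })

-- Tapes

Cell : Set
Cell = Symbol Letter (Fin 0)

WorkTape : Set
WorkTape = Tape Letter (Fin 0)

infix 4 _≈_

-- Equality up to trailing blanks.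
data _≈_ : List Cell → TernaryString → Set where
  []  : [] ≈ []
  pad : ∀ {xs} → xs ≈ [] → blank ∷ xs ≈ []
  _∷_ : ∀ {xs w} a → xs ≈ w → letter a ∷ xs ≈ a ∷ w

-- The word to the left of the head is listed from the head outwards, here and
-- in `Facing`.
data At (u v : TernaryString) : WorkTape → Set where
  at : ∀ {l x r} → l ≈ u → x ∷ r ≈ v → At u v (tape l x r)

data Before (v : TernaryString) : WorkTape → Set where
  gap : ∀ {l r} → l ≈ [] → r ≈ v → Before v (tape l blank r)

-- What a left move can lead to: `inner` while a letter is under the head, `edge` once the sweep has
-- passed the left end of the word. Leftward sweeps recurse on this alternative.
data Facing : TernaryString → TernaryString → WorkTape → Set where
  edge  : ∀ {v t} → Before v t → Facing [] v t
  inner : ∀ {a u v t} → At u (a ∷ v) t → Facing (a ∷ u) v t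

private
  variable
    t t₁ t₂ t₃ : WorkTape

moveLeft : At u v t → Facing u v (writeAndMove (Tape.head t , left) t)
moveLeft (at []      q) = edge (gap [] q)
moveLeft (at (pad p) q) = edge (gap p q)
moveLeft (at (a ∷ p) q) = inner (at p (a ∷ q))

moveRight : At u (a ∷ v) t → At (a ∷ u) v (writeAndMove (letter a , right) t)
moveRight (at p (a ∷ []))      = at (a ∷ p) (pad [])
moveRight (at p (a ∷ pad q))   = at (a ∷ p) (pad q)
moveRight (at p (a ∷ (b ∷ q))) = at (a ∷ p) (b ∷ q)

eraseRight : At [] (a ∷ v) t → At [] v (writeAndMove (blank , right) t)
eraseRight (at p (a ∷ []))      = at (pad p) (pad [])
eraseRight (at p (a ∷ pad q))   = at (pad p) (pad q)
eraseRight (at p (a ∷ (b ∷ q))) = at (pad p) (b ∷ q)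

writeRight : ∀ a → At u [] t → At (a ∷ u) [] (writeAndMove (letter a , right) t)
writeRight a (at p (pad []))      = at (a ∷ p) (pad [])
writeRight a (at p (pad (pad q))) = at (a ∷ p) (pad q)

enterRight : Before v t → At [] v (writeAndMove (blank , right) t)
enterRight (gap p [])      = at (pad p) (pad [])
enterRight (gap p (pad q)) = at (pad p) (pad q)
enterRight (gap p (a ∷ q)) = at (pad p) (a ∷ q)

pushLeft : ∀ a → Before v t → Before (a ∷ v) (writeAndMove (letter a , left) t)
pushLeft a (gap []      q) = gap [] (a ∷ q)
pushLeft a (gap (pad p) q) = gap p (a ∷ q)

at-blankTape : At [] [] blankTape
at-blankTape = at [] (pad [])

map-letter-≈ : ∀ w → map letter w ≈ w
map-letter-≈ []      = []
map-letter-≈ (a ∷ w) = a ∷ map-letter-≈ w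

at-inputTape : ∀ w → At [] w (inputTape w)
at-inputTape []      = at-blankTape
at-inputTape (a ∷ w) = at [] (a ∷ map-letter-≈ w)

outputWord-at : At u w t → outputWord t ≡ w
outputWord-at (at {l} p q) = go {l} q
  where
  go : ∀ {l x r w} → x ∷ r ≈ w → outputWord (tape l x r) ≡ w
  go (pad q)           = refl
  go (a ∷ [])          = refl
  go (a ∷ pad q)       = refl
  go {l} (a ∷ (b ∷ q)) = cong (a ∷_) (go {l} (b ∷ q))

-- The sorting machine and its phases.

-- The first tape holds v and the third ρ; a reversal appends its index to the second.
module Sorter
  (suffixes : Tree SuffixRow 8) (prefixes : Tree PrefixRow 11)
  where

  open Automata suffixes prefixes

  -- A round at the split (ρ, v): `seek` and `readV` sweep v to the right and back, which yields its
  -- suffix state; `peek` and `readU` sweep ρ from the split outwards. The verdict leads to `turn`,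
  -- which performs the reversal, or to `back` and `pop`, which return to the split and move one
  -- letter of v onto ρ.
  Control : Set
  Control = Fin 6 ⊎ Suffix ⊎ Suffix ⊎ Track

  pattern seek    = inj₁ zero
  pattern back    = inj₁ (suc zero)
  pattern pop     = inj₁ (suc (suc zero))
  pattern turn    = inj₁ (suc (suc (suc zero)))
  pattern rewind  = inj₁ (suc (suc (suc (suc zero))))
  pattern done    = inj₁ (suc (suc (suc (suc (suc zero)))))
  pattern readV l = inj₂ (inj₁ l)
  pattern peek l  = inj₂ (inj₂ (inj₁ l))
  pattern readU k = inj₂ (inj₂ (inj₂ k))

  verdict : ∀ {A : Set} → Dec A → Control
  verdict (yes _) = turn
  verdict (no _)  = back

  transition : Control → Vec Cell 3 → Maybe (Control × Vec (Cell × Move) 3)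
  transition seek      (letter a ∷ y ∷ z ∷ []) =
    just (seek , (letter a , right) ∷ (y , stay) ∷ (z , stay) ∷ [])
  transition seek      (x ∷ y ∷ z ∷ [])        =
    just (readV root , (x , left) ∷ (y , stay) ∷ (z , stay) ∷ [])
  transition (readV l) (letter a ∷ y ∷ z ∷ []) =
    just (readV (prepend a l) , (letter a , left) ∷ (y , stay) ∷ (z , stay) ∷ [])
  transition (readV l) (x ∷ y ∷ z ∷ [])        =
    just (peek l , (x , stay) ∷ (y , stay) ∷ (z , left) ∷ [])
  transition (peek l)  (x ∷ y ∷ letter a ∷ []) =
    just (readU (enter l a) , (x , stay) ∷ (y , stay) ∷ (letter a , left) ∷ [])
  transition (peek l)  (x ∷ y ∷ z ∷ [])        =
    just (back , (x , stay) ∷ (y , stay) ∷ (z , right) ∷ [])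
  transition (readU k) (x ∷ y ∷ letter a ∷ []) =
    just (readU (extend k a) , (x , stay) ∷ (y , stay) ∷ (letter a , left) ∷ [])
  transition (readU k) (x ∷ y ∷ z ∷ [])        =
    just (verdict (efficient? k) , (x , stay) ∷ (y , stay) ∷ (z , right) ∷ [])
  transition back      (x ∷ y ∷ letter a ∷ []) =
    just (back , (x , stay) ∷ (y , stay) ∷ (letter a , right) ∷ [])
  transition back      (x ∷ y ∷ z ∷ [])        =
    just (pop , (x , right) ∷ (y , stay) ∷ (z , stay) ∷ [])
  transition pop       (letter a ∷ y ∷ z ∷ []) =
    just (seek , (blank , right) ∷ (y , stay) ∷ (letter a , right) ∷ [])
  -- Here v is used up and no split was good, so the word is sorted. It remains to bring the head to
  -- the start of the output.
  transition pop       (x ∷ y ∷ z ∷ [])        =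
    just (rewind , (x , stay) ∷ (y , left) ∷ (z , stay) ∷ [])
  -- One 1 is written for each letter moved, so the index of the reversal, the length of ρ, comes
  -- out in unary.
  transition turn      (x ∷ y ∷ letter a ∷ []) =
    just (turn , (letter a , left) ∷ (letter (suc zero) , right) ∷ (blank , right) ∷ [])
  transition turn      (x ∷ y ∷ z ∷ [])        =
    just (seek , (x , right) ∷ (letter zero , right) ∷ (z , stay) ∷ [])
  transition rewind    (x ∷ letter a ∷ z ∷ []) =
    just (rewind , (x , stay) ∷ (letter a , left) ∷ (z , stay) ∷ [])
  transition rewind    (x ∷ y ∷ z ∷ [])        =
    just (done , (x , stay) ∷ (y , right) ∷ (z , stay) ∷ [])
  transition done      _                       = nothing

  finite-Track : Finite Track
  finite-Track =
    finite-× (finite-Address 8) (finite-× (finite-Address 11) (finite-× (finite-Maybe-Fin 3) (finite-Fin 2)))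

  machine : TuringMachine Letter
  machine = record
    { State       = Control
    ; finiteState = finite-⊎ (finite-Fin 6) (finite-⊎ (finite-Address 8) (finite-⊎ (finite-Address 8) finite-Track))
    ; Work        = Fin 0
    ; finiteWork  = finite-Fin 0
    ; extraTapes  = 1
    ; start       = seek
    ; δ           = transition
    }

  open TuringMachine machine using (Configuration; HaltsAfter; halted; next; step; output)

  Halts : ℕ → Configuration → TernaryString → Set
  Halts b c o = ∃[ k ] ∃[ d ] HaltsAfter k c d × output d ≡ o × k ≤ b

  private
    variable
      b m n : ℕ
      o os : TernaryString
      c c′ : Configuration

  halts-next : step c ≡ just c′ → Halts b c′ o → Halts (suc b) c o
  halts-next s (k , d , h , p , k≤b) = suc k , d , next s h , p , s≤s k≤b

  halts-mono : m ≤ n → Halts m c o → Halts n c o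
  halts-mono m≤n (k , d , h , p , k≤m) = k , d , h , p , ℕ.≤-trans k≤m m≤n

  -- Each phase takes the run of the remaining phases as a continuation, for all tapes with the
  -- right contents: tapes are known only up to trailing blanks.
  halts-seek : ∀ v → At u v t₁ → (∀ {t₁} → Facing (v ʳ++ u) [] t₁ → Halts b (readV root , t₁ ∷ t₂ ∷ t₃ ∷ []) o) →
               Halts (length v + suc b) (seek , t₁ ∷ t₂ ∷ t₃ ∷ []) o
  halts-seek []      h@(at _ (pad _)) k = halts-next refl (k (moveLeft h))
  halts-seek (a ∷ v) h@(at _ (a ∷ _)) k = halts-next refl (halts-seek v (moveRight h) k)

  halts-readV : ∀ u → Facing u v t₁ → At w [] t₃ →
                (∀ {t₁ t₃} → Before (u ʳ++ v) t₁ → Facing w [] t₃ →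
                   Halts b (peek (suffix (u ʳ++ v)) , t₁ ∷ t₂ ∷ t₃ ∷ []) o) →
                Halts (length u + suc b) (readV (suffix v) , t₁ ∷ t₂ ∷ t₃ ∷ []) o
  halts-readV []      (edge h@(gap _ _))    g@(at _ (pad _)) k = halts-next refl (k h (moveLeft g))
  halts-readV (a ∷ u) (inner h@(at _ (a ∷ _))) g                k = halts-next refl (halts-readV u (moveLeft h) g k)

  halts-readU : ∀ {κ} u → Facing u v t₃ →
                (∀ {t₃} → At [] (u ʳ++ v) t₃ →
                   Halts b (verdict (efficient? (foldl extend κ u)) , t₁ ∷ t₂ ∷ t₃ ∷ []) o) →
                Halts (length u + suc b) (readU κ , t₁ ∷ t₂ ∷ t₃ ∷ []) o
  halts-readU []      (edge h@(gap _ _))    k = halts-next refl (k (enterRight h))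
  halts-readU (a ∷ u) (inner h@(at _ (a ∷ _))) k = halts-next refl (halts-readU u (moveLeft h) k)

  halts-peek : ∀ u → Facing u [] t₃ →
               (∀ {t₃} → At [] (u ʳ++ []) t₃ → Halts b (verdict (good? u v) , t₁ ∷ t₂ ∷ t₃ ∷ []) o) →
               Halts (length u + suc b) (peek (suffix v) , t₁ ∷ t₂ ∷ t₃ ∷ []) o
  halts-peek []      (edge h@(gap _ _))       k = halts-next refl (k (enterRight h))
  halts-peek (a ∷ u) (inner h@(at _ (a ∷ _))) k = halts-next refl (halts-readU u (moveLeft h) k)

  halts-back : ∀ v → At u v t₃ → Before w t₁ →
               (∀ {t₁ t₃} → At [] w t₁ → At (v ʳ++ u) [] t₃ → Halts b (pop , t₁ ∷ t₂ ∷ t₃ ∷ []) o) →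
               Halts (length v + suc b) (back , t₁ ∷ t₂ ∷ t₃ ∷ []) o
  halts-back []      h@(at _ (pad _)) g@(gap _ _) k = halts-next refl (k (enterRight g) h)
  halts-back (a ∷ v) h@(at _ (a ∷ _)) g           k = halts-next refl (halts-back v (moveRight h) g k)

  halts-turn : ∀ v → At [] v t₃ → Before w t₁ → At os [] t₂ →
               (∀ {t₁ t₂ t₃} → At [] (v ʳ++ w) t₁ → At (encode (length v ∷ []) ʳ++ os) [] t₂ → At [] [] t₃ →
                  Halts b (seek , t₁ ∷ t₂ ∷ t₃ ∷ []) o) →
               Halts (length v + suc b) (turn , t₁ ∷ t₂ ∷ t₃ ∷ []) o
  halts-turn []      h@(at _ (pad _)) g@(gap _ _) e@(at _ (pad _)) k =
    halts-next refl (k (enterRight g) (writeRight zero e) h)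
  halts-turn (a ∷ v) h@(at _ (a ∷ _)) g@(gap _ _) e@(at _ (pad _)) k =
    halts-next refl (halts-turn v (eraseRight h) (pushLeft a g) (writeRight (suc zero) e) k)

  halts-rewind : ∀ u → Facing u w t₂ → Halts (length u + 1) (rewind , t₁ ∷ t₂ ∷ t₃ ∷ []) (u ʳ++ w)
  halts-rewind []      (edge h@(gap _ _))       =
    1 , _ , next refl (halted refl) , outputWord-at (enterRight h) , ℕ.≤-refl
  halts-rewind (a ∷ u) (inner h@(at _ (a ∷ _))) = halts-next refl (halts-rewind u (moveLeft h))

  halts-pop : At [] (a ∷ v) t₁ → At u [] t₃ →
              (∀ {t₁ t₃} → At [] v t₁ → At (a ∷ u) [] t₃ → Halts b (seek , t₁ ∷ t₂ ∷ t₃ ∷ []) o) →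
              Halts (suc b) (pop , t₁ ∷ t₂ ∷ t₃ ∷ []) o
  halts-pop h@(at _ (a ∷ _)) g@(at _ (pad _)) k = halts-next refl (k (eraseRight h) (writeRight a g))

  halts-stop : At [] [] t₁ → At os [] t₂ → Halts (suc (length os + 1)) (pop , t₁ ∷ t₂ ∷ t₃ ∷ []) (os ʳ++ [])
  halts-stop {os = os} (at _ (pad _)) e = halts-next refl (halts-rewind os (moveLeft e))

  -- Testing the split (reverse u , v) takes one sweep over either tape.
  halts-test : ∀ u v → At [] v t₁ → At u [] t₃ →
               (∀ {t₁ t₃} → Before v t₁ → At [] (reverse u) t₃ → Halts b (verdict (good? u v) , t₁ ∷ t₂ ∷ t₃ ∷ []) o) →
               Halts (length v + suc (length v + suc (length u + suc b))) (seek , t₁ ∷ t₂ ∷ t₃ ∷ []) o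
  halts-test {b = b} {t₂ = t₂} {o = o} u v h g k =
    halts-seek v h λ f →
    subst (λ n → Halts (n + suc (length u + suc b)) _ _) (List.length-reverse v)
      (halts-readV (reverse v) f g λ p q →
        halts-peek′ (reverse-ʳ++-[] v) p q)
    where
    halts-peek′ : ∀ {v′ t₁ t₃} → v′ ≡ v → Before v′ t₁ → Facing u [] t₃ →
                  Halts (length u + suc b) (peek (suffix v′) , t₁ ∷ t₂ ∷ t₃ ∷ []) o
    halts-peek′ refl p q = halts-peek u q (k p)

-- Optimal sequences together with the runs that output them, and the running time.

module Solution
  (suffixes : Tree SuffixRow 8) (prefixes : Tree PrefixRow 11)
  (valid : Automata.Valid suffixes prefixes)
  where

  open Automata suffixes prefixes
  open Potential suffixes prefixes valid
  open Sorter suffixes prefixes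

  -- With k symbols not yet tried and p the potential of the current word of
  -- length n.
  cost : ℕ → ℕ → ℕ → ℕ
  cost n p k = (p * (n + 2) + k + 1) * (2 * n + 6)

  tested : ℕ → ℕ → ℕ → ℕ
  tested r k b = k + suc (k + suc (r + suc b))

  private
    open +-*-Solver using (con; _:+_; _:*_; _:=_; solve) renaming (Polynomial to Expression)

    :cost : ∀ {m} → Expression m → Expression m → Expression m → Expression m
    :cost n p k = (p :* (n :+ con 2) :+ k :+ con 1) :* (con 2 :* n :+ con 6)

    :tested : ∀ {m} → Expression m → Expression m → Expression m → Expression m
    :tested r k b = k :+ (con 1 :+ (k :+ (con 1 :+ (r :+ (con 1 :+ b)))))

  -- In `cost`, the first factor bounds the number of rounds left and the second the length of a
  -- round. The last round fixes the second: it takes 2n + 6 steps, besides the l steps for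
  -- rewinding the output.
  cost-stop : ∀ r p l → tested r 0 (r + suc (suc (l + 1))) ≤ cost (r + 0) p 0 + l
  cost-stop r p l = ℕ.≤-trans (ℕ.m≤m+n _ (p * (r + 2) * (2 * r + 6))) (ℕ.≤-reflexive
    (solve 3 (λ r p l →
      :tested r (con 0) (r :+ (con 2 :+ (l :+ con 1))) :+ p :* (r :+ con 2) :* (con 2 :* r :+ con 6)
        := :cost (r :+ con 0) p (con 0) :+ l)
      refl r p l))

  -- A round that moves the split takes 2n + 5 steps, one less than lowering k by one sets free.
  cost-pop : ∀ r k p l →
    tested r (suc k) (r + suc (suc (cost (suc r + k) p k + l))) ≤ cost (r + suc k) p (suc k) + l
  cost-pop r k p l = ℕ.≤-trans (ℕ.m≤m+n _ 1) (ℕ.≤-reflexive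
    (solve 4 (λ r k p l →
      :tested r (con 1 :+ k) (r :+ (con 2 :+ (:cost (con 1 :+ r :+ k) p k :+ l))) :+ con 1
        := :cost (r :+ (con 1 :+ k)) p (con 1 :+ k) :+ l)
      refl r k p l))

  -- Lowering the potential by one sets n + 2 rounds free: n cover the return of k to n, one pays
  -- for the present round, and one for the r + 1 cells added to the output, which must be rewound
  -- at the end. The polynomial added below is the slack (k + 2)(2n + 6) - (2k + 3r + 5) for n = r +
  -- k.
  cost-turn : ∀ r k p l →
    tested r k (r + suc (cost (r + k) p (r + k) + (r + 1 + l))) ≤ cost (r + k) (suc p) k + l
  cost-turn r k p l = ℕ.≤-trans (ℕ.m≤m+n _ (2 * (k * k) + 2 * (k * r) + 8 * k + r + 7)) (ℕ.≤-reflexive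
    (solve 4 (λ r k p l →
      :tested r k (r :+ (con 1 :+ (:cost (r :+ k) p (r :+ k) :+ (r :+ con 1 :+ l)))) :+
        (con 2 :* (k :* k) :+ con 2 :* (k :* r) :+ con 8 :* k :+ r :+ con 7)
        := :cost (r :+ k) (con 1 :+ p) k :+ l)
      refl r k p l))

  length-encode-ʳ++ : ∀ r os → length (encode (r ∷ []) ʳ++ os) ≡ r + 1 + length os
  length-encode-ʳ++ r os = begin
    length (encode (r ∷ []) ʳ++ os)             ≡⟨ List.length-ʳ++ (encode (r ∷ [])) ⟩
    length (encode (r ∷ [])) + length os        ≡⟨ cong (_+ length os) (length-block r) ⟩
    r + 1 + length os                           ∎
    where
    open ≡-Reasoning
    length-block : ∀ r → length (encode (r ∷ [])) ≡ r + 1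
    length-block zero    = refl
    length-block (suc r) = cong suc (length-block r)

  encode-∷-ʳ++ : ∀ r is os → (encode (r ∷ []) ʳ++ os) ʳ++ encode is ≡ os ʳ++ encode (r ∷ is)
  encode-∷-ʳ++ r is os = trans (List.ʳ++-ʳ++ (encode (r ∷ [])))
    (cong (os ʳ++_) (cong (_++ encode is) (List.++-identityʳ (replicate r (suc zero) ++ zero ∷ []))))

  -- The sequence and the run are built together, so that the output is the encoding of this very
  -- sequence; `count` says that its length attains the lower bound. The output written so far is
  -- `os`, last symbol first.
  record Sorts (ρ v : TernaryString) (p : ℕ) : Set where
    field
      reversals : List ℕ
      isSorting : IsSortingSequence (ρ ʳ++ v) reversals
      count     : length reversals + 3 ≡ p
      halts     : ∀ {t₁ t₂ t₃ os} → At [] v t₁ → At os [] t₂ → At ρ [] t₃ →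
                  Halts (cost (length ρ + length v) p (length v) + length os)
                        (seek , t₁ ∷ t₂ ∷ t₃ ∷ []) (os ʳ++ encode reversals)

  open Sorts

  sort-turn : ∀ {p} a ρ v → verdict (good? (a ∷ ρ) v) ≡ turn →
              Sorts [] (a ∷ ρ ++ v) p → Sorts (a ∷ ρ) v (suc p)
  sort-turn {p} a ρ v turns S = record
    { reversals = r ∷ reversals S
    ; isSorting = isSortingSequence-∷ (a ∷ ρ) v (s≤s z≤n) (isSorting S)
    ; count     = cong suc (count S)
    ; halts     = λ {_} {_} {_} {os} h e g →
        halts-mono (cost-turn r (length v) p (length os))
          (halts-test (a ∷ ρ) v h g λ h g → turning h e g)
    }
    where
    r = length (a ∷ ρ)

    resume : ∀ {t₁ t₂ t₃ os w n} → w ≡ a ∷ ρ ++ v → n ≡ r →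
             At [] w t₁ → At (encode (n ∷ []) ʳ++ os) [] t₂ → At [] [] t₃ →
             Halts (cost (r + length v) p (r + length v) + (r + 1 + length os)) (seek , t₁ ∷ t₂ ∷ t₃ ∷ [])
                   (os ʳ++ encode (r ∷ reversals S))
    resume {os = os} refl refl h e g =
      subst (Halts _ _) (encode-∷-ʳ++ r (reversals S) os)
        (halts-mono (ℕ.≤-reflexive (cong₂ (λ n l → cost n p n + l) (List.length-++ (a ∷ ρ)) (length-encode-ʳ++ r os)))
          (halts S h e g))

    turning : ∀ {t₁ t₂ t₃ os} → Before v t₁ → At os [] t₂ → At [] (reverse (a ∷ ρ)) t₃ →
              Halts (r + suc (cost (r + length v) p (r + length v) + (r + 1 + length os)))
                    (verdict (good? (a ∷ ρ) v) , t₁ ∷ t₂ ∷ t₃ ∷ []) (os ʳ++ encode (r ∷ reversals S))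
    turning {t₁} {t₂} {t₃} {os} h e g =
      subst₂ (λ n q → Halts (n + suc (cost (r + length v) p (r + length v) + (r + 1 + length os)))
                            (q , t₁ ∷ t₂ ∷ t₃ ∷ []) (os ʳ++ encode (r ∷ reversals S)))
        (List.length-reverse (a ∷ ρ)) (sym turns)
        (halts-turn (reverse (a ∷ ρ)) g h e
          (resume (reverse-ʳ++ (a ∷ ρ) v)
                  (List.length-reverse (a ∷ ρ))))

  backing : ∀ {b t₁ t₂ t₃ o} ρ v → verdict (good? ρ v) ≡ back → Before v t₁ → At [] (reverse ρ) t₃ →
            (∀ {t₁ t₃} → At [] v t₁ → At ρ [] t₃ → Halts b (pop , t₁ ∷ t₂ ∷ t₃ ∷ []) o) →
            Halts (length ρ + suc b) (verdict (good? ρ v) , t₁ ∷ t₂ ∷ t₃ ∷ []) o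
  backing {b} {t₁} {t₂} {t₃} {o} ρ v backs h g k =
    subst₂ (λ n q → Halts (n + suc b) (q , t₁ ∷ t₂ ∷ t₃ ∷ []) o) (List.length-reverse ρ) (sym backs)
      (halts-back (reverse ρ) g h λ {_} {t₃} h g →
        k h (subst (λ ρ → At ρ [] t₃) (reverse-ʳ++-[] ρ) g))

  sort-pop : ∀ {p} ρ a v → verdict (good? ρ (a ∷ v)) ≡ back → Sorts (a ∷ ρ) v p → Sorts ρ (a ∷ v) p
  sort-pop {p} ρ a v backs S = record
    { reversals = reversals S
    ; isSorting = isSorting S
    ; count     = count S
    ; halts     = λ {_} {_} {_} {os} h e g →
        halts-mono (cost-pop (length ρ) (length v) p (length os))
          (halts-test ρ (a ∷ v) h g λ h g → backing ρ (a ∷ v) backs h g λ h g → halts-pop h g λ h g → halts S h e g)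
    }

  sort-stop : ∀ ρ → verdict (good? ρ []) ≡ back → Sorted (reverse ρ) → Sorts ρ [] (potential (reverse ρ))
  sort-stop ρ backs sorted = record
    { reversals = []
    ; isSorting = record { inRange = [] ; sorts = record { sameMultiplicities = ↭-refl ; nonDecreasing = sorted } }
    ; count     = sym (potential-sorted sorted)
    ; halts     = λ {_} {_} {_} {os} h e g →
        halts-mono (cost-stop (length ρ) (potential (reverse ρ)) (length os))
          (halts-test ρ [] h g λ h g → backing ρ [] backs h g λ h g → halts-stop h e)
    }

  -- The recursion is lexicographic: a reversal lowers `p`, and moving the split shortens `v`. The
  -- alternative passed along ensures that the end of `v` is reached only when the word is sorted.
  sort : ∀ p ρ v → potential (ρ ʳ++ v) ≡ p → Sorted (ρ ʳ++ v) ⊎ Search ρ v → Sorts ρ v p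
  sort p ρ v eq alt with good? ρ v in test
  sort p (a ∷ ρ) v eq alt | yes good with trans (sym eq) (efficient-drops a ρ v good)
  -- A good split forces the potential to be a successor. After the reversal the search starts
  -- afresh, with nothing on the third tape.
  sort (suc p) (a ∷ ρ) v eq alt | yes good | eq′ =
    sort-turn a ρ v (cong verdict test)
      (sort p [] (a ∷ ρ ++ v) (sym (ℕ.suc-injective eq′)) (sorted⊎search (a ∷ ρ ++ v)))
  sort p ρ v        eq (inj₂ (found good)) | no ¬good = ⊥-elim (¬good good)
  sort p ρ (a ∷ v)  eq (inj₂ (later alt))  | no ¬good =
    sort-pop ρ a v (cong verdict test) (sort p (a ∷ ρ) v eq (inj₂ alt))
  sort p ρ (a ∷ v)  eq (inj₁ sorted)       | no ¬good =
    sort-pop ρ a v (cong verdict test) (sort p (a ∷ ρ) v eq (inj₁ sorted))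
  sort p ρ []       refl (inj₁ sorted)     | no ¬good = sort-stop ρ (cong verdict test) sorted

  -- This is `cost n p n` at p = n + 3, which bounds the potential since there are at most n blocks
  -- and the offset is at most 3.
  timeBound : Polynomial
  timeBound = ((((var ⊕ const 3) ⊗ (var ⊕ const 2)) ⊕ var) ⊕ const 1) ⊗ ((const 2 ⊗ var) ⊕ const 6)

  sorter-correct : ∀ s → Σ[ is ∈ List ℕ ]
    (IsShortestSortingSequence s is ×
     (let open TuringMachine machine in OnInput s Outputs encode is Within eval timeBound (length s)))
  sorter-correct s = reversals S
    , record
      { isSorting = isSorting S
      ; shortest  = λ js p → ℕ.+-cancelʳ-≤ 3 _ _ (ℕ.≤-trans (ℕ.≤-reflexive (count S)) (lowerBound s js p))
      }
    , halts-mono bound (halts S (at-inputTape s) at-blankTape at-blankTape)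
    where
    n = length s
    S = sort (potential s) [] s refl (sorted⊎search s)

    bound : cost n (potential s) n + 0 ≤ eval timeBound n
    bound = ℕ.≤-trans (ℕ.≤-reflexive (ℕ.+-identityʳ _))
      (ℕ.*-monoˡ-≤ (2 * n + 6) (ℕ.+-monoˡ-≤ 1 (ℕ.+-monoˡ-≤ n (ℕ.*-monoˡ-≤ (n + 2) (potential≤ s)))))

-- The transition tables

-- Decimal fields of a row: the states after prepending 0, 1 and 2, the first letter
-- (3 for the empty word), and the insertion state.  Both tables were obtained by
-- minimisation from the distances of all words of length at most 17.
suffixRows : List ℕ
suffixRows =
  001_002_003_3_0000 ∷ 001_006_008_0_0115 ∷ 004_002_009_1_0175 ∷ 005_007_003_2_0267 ∷ 004_014_018_0_0379 ∷
  005_015_019_0_0409 ∷ 010_006_020_1_0467 ∷ 011_007_021_1_0478 ∷ 012_016_008_2_0569 ∷ 013_017_009_2_0618 ∷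
  010_030_038_0_0648 ∷ 011_031_039_0_0653 ∷ 012_032_040_0_0683 ∷ 013_033_041_0_0698 ∷ 022_014_042_1_0716 ∷
  023_015_043_1_0725 ∷ 024_016_044_1_0736 ∷ 025_017_045_1_0746 ∷ 026_034_018_2_0753 ∷ 027_035_019_2_0776 ∷
  028_036_020_2_0811 ∷ 029_037_021_2_0814 ∷ 022_062_077_0_0837 ∷ 023_063_078_0_0839 ∷ 024_064_079_0_0844 ∷
  025_073_080_0_0846 ∷ 026_065_081_0_0849 ∷ 027_066_082_0_0861 ∷ 028_067_083_0_0876 ∷ 029_068_084_0_0878 ∷
  046_030_085_1_0252 ∷ 047_031_086_1_0896 ∷ 048_032_087_1_0905 ∷ 049_033_088_1_0908 ∷ 050_034_089_1_0915 ∷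
  051_035_090_1_0923 ∷ 052_036_091_1_0933 ∷ 053_037_092_1_0934 ∷ 054_069_038_2_0941 ∷ 055_070_039_2_0946 ∷
  056_071_040_2_0966 ∷ 057_072_041_2_0968 ∷ 058_073_042_2_0970 ∷ 059_074_043_2_0971 ∷ 060_075_044_2_0974 ∷
  061_076_045_2_0980 ∷ 046_030_132_0_0150 ∷ 047_113_133_0_0987 ∷ 048_116_134_0_0989 ∷ 049_114_135_0_0990 ∷
  050_064_136_0_0993 ∷ 051_115_137_0_0994 ∷ 052_064_085_0_0126 ∷ 053_128_138_0_0996 ∷ 054_116_132_0_0150 ∷
  055_117_139_0_0999 ∷ 056_118_040_0_1011 ∷ 057_067_140_0_1013 ∷ 058_064_085_0_0166 ∷ 059_119_141_0_1015 ∷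
  060_120_148_0_1017 ∷ 061_121_142_0_1021 ∷ 093_062_085_1_0722 ∷ 094_063_143_1_0554 ∷ 052_064_085_1_0126 ∷
  095_065_149_1_1026 ∷ 096_066_144_1_1027 ∷ 097_067_085_1_0254 ∷ 098_068_145_1_1030 ∷ 099_069_146_1_1037 ∷
  100_070_147_1_1039 ∷ 101_071_148_1_1047 ∷ 102_072_148_1_1049 ∷ 052_073_149_1_1050 ∷ 103_074_150_1_1051 ∷
  052_075_148_1_0238 ∷ 058_076_151_1_1052 ∷ 054_122_077_2_1054 ∷ 094_123_078_2_1055 ∷ 101_124_079_2_1060 ∷
  052_129_080_2_1062 ∷ 104_125_081_2_1063 ∷ 105_126_082_2_1071 ∷ 106_064_083_2_1073 ∷ 107_127_084_2_1074 ∷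
  052_064_085_2_0126 ∷ 108_128_086_2_1076 ∷ 028_064_087_2_1077 ∷ 109_036_088_2_1078 ∷ 110_129_089_2_1081 ∷
  111_130_090_2_1083 ∷ 058_036_091_2_1089 ∷ 112_131_092_2_1090 ∷ 093_062_132_0_0398 ∷ 094_063_180_0_0443 ∷
  095_116_181_0_1097 ∷ 096_063_182_0_1098 ∷ 097_129_085_0_0168 ∷ 098_168_183_0_1099 ∷ 099_064_184_0_1102 ∷
  100_115_185_0_1103 ∷ 101_064_186_0_1104 ∷ 102_064_080_0_1105 ∷ 103_115_143_0_0296 ∷ 104_116_187_0_1106 ∷
  105_169_082_0_1108 ∷ 106_129_083_0_1110 ∷ 107_119_188_0_1111 ∷ 108_115_143_0_0458 ∷ 109_170_192_0_1113 ∷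
  110_171_189_0_1114 ∷ 111_172_195_0_1116 ∷ 112_173_190_0_1120 ∷ 152_113_143_1_0902 ∷ 153_114_085_1_0710 ∷
  103_115_143_1_0296 ∷ 054_116_085_1_0252 ∷ 154_117_196_1_1125 ∷ 054_118_083_1_1126 ∷ 155_119_143_1_0556 ∷
  156_120_149_1_1128 ∷ 052_121_191_1_1129 ∷ 099_122_192_1_1132 ∷ 157_123_193_1_1133 ∷ 052_124_194_1_0219 ∷
  050_125_146_1_1135 ∷ 158_126_195_1_1138 ∷ 159_127_195_1_1140 ∷ 103_128_196_1_1141 ∷ 052_129_085_1_0247 ∷
  103_130_195_1_0540 ∷ 108_131_197_1_1142 ∷ 054_064_132_2_0603 ∷ 094_174_133_2_1144 ∷ 054_175_134_2_1145 ∷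
  160_129_135_2_1146 ∷ 052_175_136_2_0605 ∷ 158_176_137_2_1148 ∷ 103_179_138_2_1150 ∷ 161_177_139_2_1151 ∷
  162_075_140_2_1155 ∷ 163_115_141_2_1157 ∷ 166_178_142_2_1158 ∷ 103_115_143_2_0296 ∷ 059_115_144_2_1159 ∷
  164_074_145_2_1160 ∷ 097_129_146_2_0604 ∷ 165_179_147_2_1163 ∷ 166_075_148_2_0592 ∷ 058_064_149_2_1165 ∷
  108_074_150_2_1166 ∷ 167_076_151_2_1167 ∷ 152_113_180_0_0672 ∷ 153_114_085_0_0710 ∷ 154_063_212_0_1169 ∷
  155_179_143_0_0460 ∷ 156_064_194_0_1170 ∷ 157_115_213_0_1171 ∷ 158_115_214_0_1172 ∷ 159_115_138_0_1173 ∷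
  160_129_192_0_1174 ∷ 161_063_215_0_1175 ∷ 162_129_140_0_1177 ∷ 163_179_141_0_1179 ∷ 164_207_218_0_1180 ∷
  165_208_216_0_1181 ∷ 166_064_148_0_0162 ∷ 167_036_148_0_1183 ∷ 198_168_143_1_0890 ∷ 094_169_141_1_1185 ∷
  058_170_085_1_0242 ∷ 199_171_149_1_1187 ∷ 200_172_196_1_1188 ∷ 103_173_217_1_1189 ∷ 157_174_218_1_1192 ∷
  052_175_184_1_0241 ∷ 103_176_219_1_0521 ∷ 100_177_193_1_1193 ∷ 058_178_148_1_1196 ∷ 103_179_143_1_0549 ∷
  094_115_180_2_0803 ∷ 054_209_181_2_1197 ∷ 094_210_182_2_1198 ∷ 201_179_183_2_1199 ∷ 052_064_184_2_0600 ∷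
  103_210_185_2_0336 ∷ 101_129_186_2_1200 ∷ 202_124_187_2_1201 ∷ 203_130_188_2_1203 ∷ 058_129_189_2_1205 ∷
  205_211_190_2_1206 ∷ 204_036_191_2_1207 ∷ 097_064_192_2_1209 ∷ 155_179_193_2_0804 ∷ 052_129_194_2_0614 ∷
  205_130_195_2_0332 ∷ 108_115_196_2_1210 ∷ 206_131_197_2_1211 ∷ 198_168_143_0_0890 ∷ 199_064_184_0_0165 ∷
  200_115_219_0_1213 ∷ 201_179_218_0_1214 ∷ 202_116_224_0_1215 ∷ 203_179_188_0_1217 ∷ 204_064_225_0_0164 ∷
  205_115_195_0_0454 ∷ 206_074_195_0_1219 ∷ 108_207_143_1_0544 ∷ 220_208_196_1_1221 ∷ 052_209_225_1_1222 ∷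
  103_210_213_1_0543 ∷ 108_211_195_1_1223 ∷ 094_223_212_2_1224 ∷ 103_115_213_2_0312 ∷ 158_179_214_2_1225 ∷
  221_176_215_2_1226 ∷ 108_179_216_2_1228 ∷ 222_074_217_2_1229 ∷ 155_115_218_2_1231 ∷ 103_179_219_2_0346 ∷
  220_115_213_0_0457 ∷ 221_063_226_0_1232 ∷ 222_115_227_0_0456 ∷ 103_223_227_1_1234 ∷ 202_129_224_2_1235 ∷
  058_064_225_2_0613 ∷ 221_179_226_2_1237 ∷ 108_115_227_2_0371 ∷ []

-- Decimal fields of a row: the states after appending 0, 1 and 2, and the offset.
prefixRows₀ : List ℕ
prefixRows₀ =
  0001_0002_0003_3 ∷ 0001_0004_0005_2 ∷ 0006_0002_0007_2 ∷ 0008_0009_0003_2 ∷ 0010_0004_0011_1 ∷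
  0012_0013_0005_1 ∷ 0006_0014_0015_2 ∷ 0016_0017_0007_1 ∷ 0008_0018_0019_2 ∷ 0020_0009_0021_2 ∷
  0010_0022_0023_2 ∷ 0020_0024_0011_0 ∷ 0012_0025_0019_2 ∷ 0026_0013_0027_3 ∷ 0028_0014_0029_1 ∷
  0030_0031_0015_1 ∷ 0016_0032_0033_2 ∷ 0034_0017_0035_2 ∷ 0036_0018_0037_2 ∷ 0038_0039_0019_1 ∷
  0020_0034_0040_1 ∷ 0041_0042_0021_1 ∷ 0043_0022_0029_1 ∷ 0044_0045_0023_1 ∷ 0034_0024_0046_2 ∷
  0044_0025_0047_2 ∷ 0026_0048_0049_2 ∷ 0050_0051_0027_2 ∷ 0028_0022_0052_2 ∷ 0034_0034_0029_0 ∷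
  0030_0025_0053_2 ∷ 0054_0031_0037_2 ∷ 0055_0032_0056_2 ∷ 0057_0058_0033_1 ∷ 0034_0034_0029_1 ∷
  0059_0042_0035_1 ∷ 0036_0060_0061_2 ∷ 0062_0034_0037_1 ∷ 0038_0025_0063_2 ∷ 0020_0039_0064_2 ∷
  0034_0048_0040_0 ∷ 0041_0065_0066_2 ∷ 0034_0042_0067_2 ∷ 0043_0022_0068_2 ∷ 0044_0060_0068_2 ∷
  0069_0045_0070_2 ∷ 0034_0024_0046_1 ∷ 0034_0034_0047_1 ∷ 0034_0048_0071_2 ∷ 0072_0073_0049_1 ∷
  0050_0074_0064_2 ∷ 0075_0051_0076_2 ∷ 0044_0077_0052_1 ∷ 0078_0079_0053_1 ∷ 0054_0034_0080_2 ∷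
  0055_0081_0082_2 ∷ 0083_0081_0056_1 ∷ 0057_0084_0085_2 ∷ 0034_0058_0064_2 ∷ 0059_0086_0066_2 ∷
  0087_0060_0047_2 ∷ 0087_0088_0061_1 ∷ 0062_0089_0090_2 ∷ 0091_0042_0063_1 ∷ 0092_0042_0064_1 ∷
  0093_0065_0094_2 ∷ 0095_0042_0066_1 ∷ 0096_0042_0067_1 ∷ 0087_0081_0068_1 ∷ 0069_0034_0097_2 ∷
  0072_0034_0070_1 ∷ 0034_0081_0071_1 ∷ 0072_0081_0047_2 ∷ 0034_0073_0098_2 ∷ 0099_0074_0047_2 ∷
  0075_0081_0046_2 ∷ 0096_0100_0076_1 ∷ 0101_0077_0047_2 ∷ 0078_0025_0102_2 ∷ 0054_0079_0047_2 ∷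
  0103_0081_0080_1 ∷ 0034_0081_0047_2 ∷ 0072_0104_0082_1 ∷ 0083_0081_0105_2 ∷ 0034_0084_0106_2 ∷
  0057_0042_0085_1 ∷ 0107_0086_0108_2 ∷ 0087_0060_0109_2 ∷ 0034_0088_0070_2 ∷ 0072_0089_0047_2 ∷
  0110_0034_0090_1 ∷ 0091_0060_0063_2 ∷ 0092_0081_0067_2 ∷ 0093_0081_0070_2 ∷ 0099_0034_0094_1 ∷
  0095_0081_0064_2 ∷ 0096_0034_0067_2 ∷ 0107_0081_0097_1 ∷ 0072_0024_0098_1 ∷ 0099_0081_0090_2 ∷
  0111_0100_0076_2 ∷ 0101_0034_0108_2 ∷ 0112_0113_0102_1 ∷ 0103_0034_0106_2 ∷ 0034_0104_0108_2 ∷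
  0114_0081_0105_1 ∷ 0103_0034_0106_1 ∷ 0107_0034_0047_2 ∷ 0107_0034_0108_1 ∷ 0087_0034_0109_1 ∷
  0110_0081_0029_1 ∷ 0111_0034_0046_2 ∷ 0112_0060_0102_2 ∷ 0103_0113_0047_2 ∷ 0114_0081_0106_2 ∷
  0116_0117_0118_2 ∷ 0116_0119_0120_2 ∷ 0121_0117_0122_2 ∷ 0123_0124_0118_2 ∷ 0125_0119_0126_2 ∷
  0127_0128_0120_2 ∷ 0121_0129_0130_2 ∷ 0131_0132_0122_2 ∷ 0123_0133_0134_2 ∷ 0126_0124_0135_1 ∷
  0125_0136_0137_2 ∷ 0126_0126_0126_1 ∷ 0127_0136_0134_2 ∷ 0138_0128_0139_2 ∷ 0140_0129_0126_2 ∷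
  0141_0142_0130_2 ∷ 0131_0143_0144_2 ∷ 0126_0132_0145_1 ∷ 0146_0133_0147_2 ∷ 0127_0148_0134_2 ∷
  0149_0148_0135_2 ∷ 0150_0136_0126_2 ∷ 0150_0151_0137_2 ∷ 0138_0126_0152_2 ∷ 0153_0154_0139_2 ∷
  0140_0136_0155_2 ∷ 0141_0136_0156_2 ∷ 0157_0142_0147_2 ∷ 0138_0143_0157_2 ∷ 0158_0148_0144_2 ∷
  0159_0148_0145_2 ∷ 0146_0136_0160_2 ∷ 0161_0126_0147_2 ∷ 0126_0148_0162_1 ∷ 0149_0151_0162_2 ∷
  0150_0136_0163_2 ∷ 0164_0151_0165_2 ∷ 0166_0167_0152_2 ∷ 0153_0168_0162_2 ∷ 0166_0154_0169_2 ∷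
  0150_0170_0155_2 ∷ 0141_0171_0156_2 ∷ 0157_0126_0157_2 ∷ 0158_0172_0144_2 ∷ 0159_0173_0162_2 ∷
  0150_0167_0160_2 ∷ 0161_0168_0126_2 ∷ 0174_0148_0162_2 ∷ 0150_0126_0163_2 ∷ 0164_0126_0165_2 ∷
  0166_0126_0165_2 ∷ 0166_0126_0126_2 ∷ 0126_0167_0165_1 ∷ 0166_0168_0126_2 ∷ 0174_0154_0169_2 ∷
  0164_0170_0126_2 ∷ 0157_0171_0126_2 ∷ 0126_0172_0157_1 ∷ 0166_0173_0165_2 ∷ 0174_0126_0162_2 ∷
  0176_0177_0178_2 ∷ 0176_0179_0180_1 ∷ 0181_0177_0182_2 ∷ 0183_0184_0178_2 ∷ 0185_0179_0186_1 ∷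
  0187_0188_0180_3 ∷ 0181_0189_0190_1 ∷ 0191_0192_0182_2 ∷ 0183_0193_0194_2 ∷ 0195_0184_0196_2 ∷
  0185_0197_0198_1 ∷ 0195_0199_0186_2 ∷ 0187_0200_0194_2 ∷ 0201_0188_0202_3 ∷ 0203_0189_0126_1 ∷
  0204_0205_0190_2 ∷ 0191_0206_0207_2 ∷ 0126_0192_0208_2 ∷ 0209_0193_0210_2 ∷ 0211_0212_0194_2 ∷
  0195_0126_0213_1 ∷ 0214_0215_0196_2 ∷ 0216_0197_0126_1 ∷ 0217_0218_0198_2 ∷ 0126_0199_0199_2 ∷
  0217_0200_0126_2 ∷ 0201_0219_0220_2 ∷ 0221_0222_0202_2 ∷ 0203_0197_0223_1 ∷ 0204_0200_0224_2 ∷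
  0225_0205_0210_2 ∷ 0226_0206_0227_2 ∷ 0228_0229_0207_2 ∷ 0230_0215_0208_2 ∷ 0209_0231_0232_2 ∷
  0233_0126_0210_1 ∷ 0211_0200_0234_2 ∷ 0195_0212_0235_2 ∷ 0126_0219_0213_2 ∷ 0214_0236_0237_2 ∷
  0126_0215_0238_2 ∷ 0216_0197_0239_1 ∷ 0217_0231_0239_2 ∷ 0225_0218_0240_2 ∷ 0126_0219_0241_2 ∷
  0242_0243_0220_2 ∷ 0221_0244_0235_2 ∷ 0245_0222_0246_2 ∷ 0217_0247_0223_2 ∷ 0248_0249_0224_2 ∷
  0225_0126_0241_1 ∷ 0226_0247_0250_2 ∷ 0226_0247_0227_2 ∷ 0228_0247_0251_2 ∷ 0126_0229_0235_2 ∷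
  0230_0247_0237_2 ∷ 0252_0231_0126_2 ∷ 0252_0253_0232_2 ∷ 0233_0254_0240_2 ∷ 0255_0215_0234_2 ∷
  0256_0215_0235_2 ∷ 0257_0236_0258_2 ∷ 0259_0215_0237_2 ∷ 0260_0215_0238_2 ∷ 0252_0247_0239_2 ∷
  0242_0126_0240_1 ∷ 0126_0247_0241_2 ∷ 0242_0247_0126_2 ∷ 0126_0243_0261_2 ∷ 0257_0244_0126_2 ∷
  0245_0247_0199_2 ∷ 0260_0262_0246_2 ∷ 0126_0247_0126_2 ∷ 0248_0200_0263_2 ∷ 0225_0249_0126_2 ∷ []

prefixRows₁ : List ℕ
prefixRows₁ =
  0242_0247_0250_2 ∷ 0228_0215_0251_2 ∷ 0252_0231_0264_2 ∷ 0126_0253_0240_2 ∷ 0242_0254_0126_2 ∷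
  0255_0231_0234_2 ∷ 0256_0247_0238_2 ∷ 0257_0247_0240_2 ∷ 0257_0126_0258_1 ∷ 0259_0247_0235_2 ∷
  0260_0126_0238_1 ∷ 0242_0199_0261_2 ∷ 0265_0262_0246_2 ∷ 0266_0247_0263_2 ∷ 0252_0126_0264_1 ∷
  0265_0126_0199_1 ∷ 0266_0231_0263_2 ∷ 0268_0269_0270_2 ∷ 0268_0271_0272_1 ∷ 0273_0269_0274_1 ∷
  0275_0276_0270_2 ∷ 0277_0271_0278_0 ∷ 0279_0280_0272_1 ∷ 0273_0281_0282_1 ∷ 0283_0284_0274_1 ∷
  0275_0285_0286_1 ∷ 0287_0276_0288_1 ∷ 0277_0289_0290_1 ∷ 0287_0291_0278_0 ∷ 0279_0292_0286_1 ∷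
  0293_0280_0294_2 ∷ 0295_0281_0296_0 ∷ 0297_0298_0282_1 ∷ 0283_0299_0300_1 ∷ 0296_0284_0301_1 ∷
  0302_0285_0303_1 ∷ 0304_0305_0286_1 ∷ 0287_0296_0306_0 ∷ 0307_0308_0288_1 ∷ 0309_0289_0296_0 ∷
  0310_0311_0290_1 ∷ 0296_0291_0291_1 ∷ 0310_0292_0312_1 ∷ 0293_0313_0314_1 ∷ 0315_0316_0294_2 ∷
  0295_0289_0317_1 ∷ 0296_0296_0296_0 ∷ 0297_0292_0318_1 ∷ 0319_0298_0303_1 ∷ 0320_0299_0321_1 ∷
  0322_0323_0300_1 ∷ 0324_0308_0301_1 ∷ 0302_0325_0326_1 ∷ 0327_0296_0303_1 ∷ 0304_0292_0328_1 ∷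
  0287_0305_0329_1 ∷ 0296_0313_0306_0 ∷ 0307_0330_0331_1 ∷ 0296_0308_0332_1 ∷ 0309_0289_0333_1 ∷
  0310_0325_0333_1 ∷ 0334_0311_0335_1 ∷ 0296_0296_0312_1 ∷ 0296_0313_0336_1 ∷ 0337_0338_0314_1 ∷
  0315_0339_0329_1 ∷ 0340_0316_0341_1 ∷ 0310_0342_0317_1 ∷ 0343_0344_0318_1 ∷ 0319_0296_0345_1 ∷
  0320_0346_0347_1 ∷ 0348_0346_0321_1 ∷ 0322_0349_0350_1 ∷ 0296_0323_0329_1 ∷ 0324_0351_0331_1 ∷
  0352_0325_0312_1 ∷ 0352_0353_0326_1 ∷ 0327_0354_0355_1 ∷ 0356_0308_0328_1 ∷ 0357_0308_0329_1 ∷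
  0358_0330_0359_1 ∷ 0360_0308_0331_1 ∷ 0361_0308_0332_1 ∷ 0352_0346_0333_1 ∷ 0334_0296_0362_1 ∷
  0337_0296_0335_1 ∷ 0296_0346_0336_1 ∷ 0337_0346_0312_1 ∷ 0296_0338_0363_1 ∷ 0364_0339_0312_1 ∷
  0340_0346_0291_1 ∷ 0361_0365_0341_1 ∷ 0366_0342_0312_1 ∷ 0343_0292_0367_1 ∷ 0319_0344_0312_1 ∷
  0368_0346_0345_1 ∷ 0296_0346_0312_1 ∷ 0337_0369_0347_1 ∷ 0348_0346_0370_1 ∷ 0296_0349_0368_1 ∷
  0322_0308_0350_1 ∷ 0371_0351_0372_1 ∷ 0352_0325_0373_1 ∷ 0296_0353_0335_1 ∷ 0337_0354_0312_1 ∷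
  0374_0296_0355_1 ∷ 0356_0325_0328_1 ∷ 0357_0346_0332_1 ∷ 0358_0346_0335_1 ∷ 0364_0296_0359_1 ∷
  0360_0346_0329_1 ∷ 0361_0296_0332_1 ∷ 0371_0346_0362_1 ∷ 0337_0291_0363_1 ∷ 0364_0346_0355_1 ∷
  0375_0365_0341_1 ∷ 0366_0296_0372_1 ∷ 0376_0377_0367_1 ∷ 0368_0296_0368_1 ∷ 0296_0369_0372_1 ∷
  0378_0346_0370_1 ∷ 0371_0296_0312_1 ∷ 0371_0296_0372_1 ∷ 0352_0296_0373_1 ∷ 0374_0346_0296_0 ∷
  0375_0296_0291_1 ∷ 0376_0325_0367_1 ∷ 0368_0377_0312_1 ∷ 0378_0346_0368_1 ∷ 0380_0381_0382_1 ∷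
  0380_0383_0384_1 ∷ 0385_0381_0386_1 ∷ 0387_0388_0382_2 ∷ 0389_0383_0126_1 ∷ 0146_0390_0384_2 ∷
  0385_0391_0392_1 ∷ 0393_0394_0386_2 ∷ 0387_0395_0160_2 ∷ 0126_0388_0396_1 ∷ 0389_0391_0160_1 ∷
  0138_0390_0397_2 ∷ 0398_0391_0126_1 ∷ 0150_0399_0392_2 ∷ 0393_0400_0401_2 ∷ 0126_0394_0402_1 ∷
  0146_0395_0403_2 ∷ 0404_0126_0396_2 ∷ 0405_0168_0397_2 ∷ 0398_0391_0163_1 ∷ 0126_0399_0403_1 ∷
  0164_0400_0406_2 ∷ 0157_0167_0401_2 ∷ 0407_0126_0402_2 ∷ 0408_0126_0403_2 ∷ 0404_0400_0406_2 ∷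
  0405_0170_0165_2 ∷ 0164_0126_0406_2 ∷ 0407_0126_0406_2 ∷ 0408_0168_0165_2 ∷ 0410_0411_0412_1 ∷
  0410_0413_0414_1 ∷ 0415_0411_0416_1 ∷ 0417_0418_0412_1 ∷ 0419_0413_0296_1 ∷ 0420_0421_0414_1 ∷
  0415_0422_0423_1 ∷ 0424_0425_0416_1 ∷ 0417_0426_0427_1 ∷ 0296_0418_0428_0 ∷ 0419_0429_0430_1 ∷
  0420_0429_0427_1 ∷ 0431_0421_0432_1 ∷ 0433_0422_0296_1 ∷ 0434_0435_0423_1 ∷ 0424_0436_0437_1 ∷
  0296_0425_0438_0 ∷ 0439_0426_0440_1 ∷ 0420_0441_0427_1 ∷ 0442_0441_0428_1 ∷ 0443_0429_0296_1 ∷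
  0443_0444_0430_1 ∷ 0431_0296_0445_1 ∷ 0446_0447_0432_1 ∷ 0433_0429_0448_1 ∷ 0434_0429_0449_1 ∷
  0368_0435_0440_1 ∷ 0431_0436_0368_1 ∷ 0450_0441_0437_1 ∷ 0451_0441_0438_1 ∷ 0439_0429_0452_1 ∷
  0453_0296_0440_1 ∷ 0296_0441_0454_0 ∷ 0442_0444_0454_1 ∷ 0443_0429_0455_1 ∷ 0456_0444_0457_1 ∷
  0458_0459_0445_1 ∷ 0446_0460_0454_1 ∷ 0458_0447_0461_1 ∷ 0443_0462_0448_1 ∷ 0434_0463_0449_1 ∷
  0450_0464_0437_1 ∷ 0451_0465_0454_1 ∷ 0443_0459_0452_1 ∷ 0453_0460_0296_1 ∷ 0466_0441_0454_1 ∷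
  0443_0296_0455_1 ∷ 0456_0296_0457_1 ∷ 0458_0296_0457_1 ∷ 0458_0296_0296_1 ∷ 0296_0459_0457_0 ∷
  0458_0460_0296_1 ∷ 0466_0447_0461_1 ∷ 0456_0462_0296_1 ∷ 0368_0463_0296_1 ∷ 0296_0464_0368_0 ∷
  0458_0465_0457_1 ∷ 0466_0296_0454_1 ∷ 0468_0469_0470_2 ∷ 0468_0200_0471_2 ∷ 0472_0469_0473_2 ∷
  0474_0475_0470_1 ∷ 0252_0243_0471_2 ∷ 0472_0200_0476_2 ∷ 0242_0475_0473_1 ∷ 0474_0477_0264_2 ∷
  0126_0475_0240_1 ∷ 0266_0253_0476_2 ∷ 0252_0477_0240_2 ∷ 0479_0480_0481_1 ∷ 0479_0482_0483_0 ∷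
  0484_0480_0485_1 ∷ 0486_0487_0481_1 ∷ 0488_0482_0489_0 ∷ 0490_0491_0483_2 ∷ 0484_0492_0493_0 ∷
  0494_0495_0485_1 ∷ 0486_0496_0497_1 ∷ 0498_0487_0499_1 ∷ 0488_0500_0501_0 ∷ 0498_0291_0489_1 ∷
  0490_0502_0497_1 ∷ 0503_0491_0504_2 ∷ 0505_0492_0296_0 ∷ 0506_0507_0493_1 ∷ 0494_0508_0509_1 ∷
  0296_0495_0510_1 ∷ 0511_0496_0512_1 ∷ 0513_0514_0497_1 ∷ 0498_0296_0515_0 ∷ 0516_0517_0499_1 ∷ []

prefixRows₂ : List ℕ
prefixRows₂ =
  0518_0500_0296_0 ∷ 0519_0520_0501_1 ∷ 0519_0502_0296_1 ∷ 0503_0521_0522_1 ∷ 0523_0524_0504_1 ∷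
  0505_0500_0525_0 ∷ 0506_0502_0526_1 ∷ 0527_0507_0512_1 ∷ 0528_0508_0529_1 ∷ 0530_0531_0509_1 ∷
  0532_0517_0510_1 ∷ 0511_0533_0534_1 ∷ 0535_0296_0512_0 ∷ 0513_0502_0536_1 ∷ 0498_0514_0537_1 ∷
  0296_0521_0515_1 ∷ 0516_0538_0539_1 ∷ 0296_0517_0540_1 ∷ 0518_0500_0541_0 ∷ 0519_0533_0541_1 ∷
  0527_0520_0542_1 ∷ 0296_0521_0543_1 ∷ 0544_0545_0522_1 ∷ 0523_0546_0537_1 ∷ 0547_0524_0548_1 ∷
  0519_0549_0525_1 ∷ 0550_0551_0526_1 ∷ 0527_0296_0543_0 ∷ 0528_0549_0552_1 ∷ 0528_0549_0529_1 ∷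
  0530_0549_0553_1 ∷ 0296_0531_0537_1 ∷ 0532_0549_0539_1 ∷ 0554_0533_0296_1 ∷ 0554_0555_0534_1 ∷
  0535_0556_0542_1 ∷ 0557_0517_0536_1 ∷ 0558_0517_0537_1 ∷ 0559_0538_0560_1 ∷ 0561_0517_0539_1 ∷
  0562_0517_0540_1 ∷ 0554_0549_0541_1 ∷ 0544_0296_0542_0 ∷ 0296_0549_0543_1 ∷ 0544_0549_0296_1 ∷
  0296_0545_0563_1 ∷ 0559_0546_0296_1 ∷ 0547_0549_0291_1 ∷ 0562_0564_0548_1 ∷ 0296_0549_0296_1 ∷
  0550_0502_0565_1 ∷ 0527_0551_0296_1 ∷ 0544_0549_0552_1 ∷ 0530_0517_0553_1 ∷ 0554_0533_0566_1 ∷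
  0296_0555_0542_1 ∷ 0544_0556_0296_1 ∷ 0557_0533_0536_1 ∷ 0558_0549_0540_1 ∷ 0559_0549_0542_1 ∷
  0559_0296_0560_0 ∷ 0561_0549_0537_1 ∷ 0562_0296_0540_0 ∷ 0544_0291_0563_1 ∷ 0567_0564_0548_1 ∷
  0568_0549_0565_1 ∷ 0554_0296_0566_0 ∷ 0567_0296_0291_0 ∷ 0568_0533_0565_1 ∷ 0570_0571_0572_2 ∷
  0570_0573_0574_2 ∷ 0575_0571_0576_2 ∷ 0577_0578_0572_2 ∷ 0579_0573_0126_1 ∷ 0580_0581_0574_2 ∷
  0575_0582_0583_2 ∷ 0584_0585_0576_2 ∷ 0577_0586_0587_2 ∷ 0126_0578_0588_2 ∷ 0579_0589_0590_2 ∷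
  0580_0589_0587_2 ∷ 0591_0581_0592_2 ∷ 0593_0582_0126_1 ∷ 0594_0595_0583_2 ∷ 0584_0596_0597_2 ∷
  0126_0585_0598_2 ∷ 0599_0586_0600_2 ∷ 0580_0601_0587_2 ∷ 0602_0601_0588_2 ∷ 0603_0589_0126_1 ∷
  0603_0604_0590_2 ∷ 0591_0126_0605_2 ∷ 0606_0601_0592_2 ∷ 0593_0589_0607_2 ∷ 0594_0589_0608_2 ∷
  0157_0595_0600_2 ∷ 0591_0596_0157_2 ∷ 0609_0601_0597_2 ∷ 0610_0601_0598_2 ∷ 0599_0589_0611_2 ∷
  0126_0126_0600_2 ∷ 0126_0601_0592_2 ∷ 0602_0604_0592_2 ∷ 0603_0589_0612_2 ∷ 0613_0604_0600_2 ∷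
  0126_0614_0605_2 ∷ 0606_0126_0592_2 ∷ 0603_0615_0607_2 ∷ 0594_0616_0608_2 ∷ 0609_0617_0597_2 ∷
  0610_0614_0592_2 ∷ 0603_0614_0611_2 ∷ 0603_0126_0612_2 ∷ 0613_0126_0600_2 ∷ 0126_0614_0600_2 ∷
  0613_0615_0126_1 ∷ 0157_0616_0126_1 ∷ 0126_0617_0157_2 ∷ 0619_0620_0621_2 ∷ 0619_0622_0623_3 ∷
  0624_0620_0625_2 ∷ 0626_0581_0621_2 ∷ 0627_0622_0628_2 ∷ 0626_0629_0623_3 ∷ 0624_0630_0631_2 ∷
  0632_0601_0625_2 ∷ 0626_0615_0633_2 ∷ 0627_0634_0635_2 ∷ 0591_0199_0628_2 ∷ 0636_0629_0637_2 ∷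
  0638_0630_0126_1 ∷ 0639_0615_0631_2 ∷ 0632_0640_0592_2 ∷ 0641_0581_0633_2 ∷ 0642_0634_0126_1 ∷
  0613_0615_0635_2 ∷ 0636_0614_0199_2 ∷ 0606_0643_0637_2 ∷ 0638_0634_0644_2 ∷ 0639_0615_0645_2 ∷
  0613_0640_0644_2 ∷ 0641_0615_0592_2 ∷ 0642_0634_0600_2 ∷ 0646_0643_0637_2 ∷ 0613_0126_0644_2 ∷
  0647_0615_0645_2 ∷ 0646_0126_0199_2 ∷ 0647_0615_0157_2 ∷ 0146_0649_0650_2 ∷ 0146_0649_0152_2 ∷
  0651_0167_0650_2 ∷ 0651_0652_0163_2 ∷ 0150_0652_0165_2 ∷ 0654_0655_0656_0 ∷ 0654_0657_0658_0 ∷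
  0659_0655_0660_0 ∷ 0661_0662_0656_1 ∷ 0663_0657_0296_0 ∷ 0439_0664_0658_1 ∷ 0659_0665_0666_0 ∷
  0667_0668_0660_1 ∷ 0661_0669_0452_1 ∷ 0296_0662_0670_0 ∷ 0663_0665_0452_0 ∷ 0431_0664_0671_1 ∷
  0672_0665_0296_0 ∷ 0443_0673_0666_1 ∷ 0667_0674_0675_1 ∷ 0296_0668_0676_0 ∷ 0439_0669_0677_1 ∷
  0678_0296_0670_1 ∷ 0679_0460_0671_1 ∷ 0672_0665_0455_0 ∷ 0296_0673_0677_0 ∷ 0456_0674_0680_1 ∷
  0368_0459_0675_1 ∷ 0681_0296_0676_1 ∷ 0682_0296_0677_1 ∷ 0678_0674_0680_1 ∷ 0679_0462_0457_1 ∷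
  0456_0296_0680_1 ∷ 0681_0296_0680_1 ∷ 0682_0460_0457_1 ∷ 0684_0685_0686_2 ∷ 0684_0687_0688_2 ∷
  0689_0685_0690_2 ∷ 0127_0691_0686_2 ∷ 0692_0687_0126_2 ∷ 0127_0693_0688_2 ∷ 0689_0687_0156_2 ∷
  0694_0148_0690_2 ∷ 0126_0691_0695_1 ∷ 0692_0136_0696_2 ∷ 0166_0693_0162_2 ∷ 0694_0697_0144_2 ∷
  0153_0148_0695_2 ∷ 0150_0168_0696_2 ∷ 0166_0697_0157_2 ∷ 0699_0700_0701_3 ∷ 0699_0702_0703_3 ∷
  0704_0700_0145_2 ∷ 0705_0693_0701_2 ∷ 0706_0702_0165_2 ∷ 0705_0154_0703_2 ∷ 0704_0707_0708_2 ∷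
  0705_0168_0709_2 ∷ 0706_0710_0711_2 ∷ 0712_0707_0126_2 ∷ 0713_0168_0708_2 ∷ 0153_0693_0709_2 ∷
  0710_0710_0126_2 ∷ 0166_0168_0711_2 ∷ 0712_0710_0165_2 ∷ 0713_0168_0714_2 ∷ 0715_0168_0714_2 ∷
  0715_0168_0157_2 ∷ 0717_0718_0470_1 ∷ 0717_0719_0720_1 ∷ 0721_0718_0240_1 ∷ 0722_0719_0126_1 ∷
  0252_0723_0720_2 ∷ 0721_0719_0724_1 ∷ 0722_0719_0264_1 ∷ 0126_0723_0250_2 ∷ 0252_0475_0724_1 ∷
  0726_0727_0728_1 ∷ 0726_0502_0729_1 ∷ 0730_0727_0731_1 ∷ 0732_0733_0728_0 ∷ 0554_0545_0729_1 ∷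
  0730_0502_0734_1 ∷ 0544_0733_0731_0 ∷ 0732_0735_0566_1 ∷ 0296_0733_0542_0 ∷ 0568_0555_0734_1 ∷
  0554_0735_0542_1 ∷ 0737_0738_0739_2 ∷ 0737_0740_0741_1 ∷ 0225_0738_0742_2 ∷ 0743_0229_0739_2 ∷
  0225_0740_0126_1 ∷ 0260_0744_0741_2 ∷ 0745_0229_0742_2 ∷ 0743_0249_0238_2 ∷ 0225_0744_0238_2 ∷
  0745_0249_0251_2 ∷ 0747_0229_0748_2 ∷ 0747_0749_0750_2 ∷ 0751_0744_0748_2 ∷ 0126_0749_0752_2 ∷ []

prefixRows₃ : List ℕ
prefixRows₃ =
  0751_0222_0750_2 ∷ 0751_0126_0741_1 ∷ 0225_0199_0752_2 ∷ 0754_0755_0756_2 ∷ 0754_0757_0758_2 ∷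
  0759_0755_0760_2 ∷ 0761_0762_0756_2 ∷ 0599_0757_0126_1 ∷ 0599_0763_0758_2 ∷ 0759_0589_0764_2 ∷
  0765_0766_0760_2 ∷ 0761_0767_0611_2 ∷ 0126_0762_0768_2 ∷ 0591_0763_0769_2 ∷ 0603_0770_0764_2 ∷
  0765_0640_0771_2 ∷ 0126_0766_0772_2 ∷ 0599_0767_0644_2 ∷ 0773_0126_0768_2 ∷ 0774_0126_0769_2 ∷
  0126_0770_0644_2 ∷ 0157_0614_0771_2 ∷ 0775_0126_0772_2 ∷ 0773_0640_0644_2 ∷ 0774_0615_0600_2 ∷
  0775_0126_0644_2 ∷ 0777_0778_0779_1 ∷ 0777_0780_0781_1 ∷ 0782_0778_0783_1 ∷ 0784_0785_0779_1 ∷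
  0786_0780_0296_0 ∷ 0787_0788_0781_1 ∷ 0782_0789_0790_1 ∷ 0791_0323_0783_1 ∷ 0784_0792_0793_1 ∷
  0296_0785_0794_1 ∷ 0786_0795_0796_1 ∷ 0787_0795_0793_1 ∷ 0797_0788_0332_1 ∷ 0798_0789_0296_0 ∷
  0799_0377_0790_1 ∷ 0791_0800_0350_1 ∷ 0801_0792_0312_1 ∷ 0787_0308_0793_1 ∷ 0802_0308_0794_1 ∷
  0803_0795_0296_0 ∷ 0803_0804_0796_1 ∷ 0797_0296_0336_1 ∷ 0798_0795_0805_1 ∷ 0799_0795_0806_1 ∷
  0797_0800_0368_1 ∷ 0801_0795_0807_1 ∷ 0802_0804_0332_1 ∷ 0803_0795_0808_1 ∷ 0371_0804_0312_1 ∷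
  0803_0809_0805_1 ∷ 0799_0810_0806_1 ∷ 0803_0346_0807_1 ∷ 0803_0296_0808_1 ∷ 0371_0809_0296_0 ∷
  0368_0810_0296_0 ∷ 0812_0813_0126_1 ∷ 0812_0615_0199_2 ∷ 0647_0813_0126_1 ∷ 0815_0816_0817_1 ∷
  0815_0818_0819_2 ∷ 0820_0816_0821_1 ∷ 0822_0788_0817_1 ∷ 0823_0818_0824_1 ∷ 0822_0316_0819_2 ∷
  0820_0825_0826_1 ∷ 0827_0308_0821_1 ∷ 0822_0809_0828_1 ∷ 0823_0829_0830_1 ∷ 0797_0291_0824_1 ∷
  0831_0825_0296_0 ∷ 0832_0809_0826_1 ∷ 0827_0351_0332_1 ∷ 0833_0788_0828_1 ∷ 0834_0829_0296_0 ∷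
  0371_0809_0830_1 ∷ 0831_0829_0372_1 ∷ 0832_0809_0835_1 ∷ 0833_0809_0332_1 ∷ 0834_0829_0312_1 ∷
  0836_0809_0835_1 ∷ 0836_0809_0368_1 ∷ 0389_0838_0650_1 ∷ 0389_0838_0165_1 ∷ 0439_0840_0841_1 ∷
  0439_0840_0445_1 ∷ 0842_0459_0841_1 ∷ 0842_0843_0455_1 ∷ 0443_0843_0457_1 ∷ 0126_0845_0152_1 ∷
  0126_0845_0401_1 ∷ 0847_0167_0126_2 ∷ 0847_0126_0848_2 ∷ 0126_0168_0848_1 ∷ 0850_0851_0852_2 ∷
  0850_0136_0853_2 ∷ 0146_0851_0854_2 ∷ 0651_0855_0852_2 ∷ 0150_0856_0853_2 ∷ 0857_0858_0854_2 ∷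
  0126_0855_0859_1 ∷ 0166_0856_0147_2 ∷ 0857_0173_0157_2 ∷ 0126_0858_0406_1 ∷ 0860_0126_0859_2 ∷
  0860_0173_0165_2 ∷ 0862_0863_0864_1 ∷ 0862_0865_0866_1 ∷ 0867_0863_0868_1 ∷ 0420_0869_0864_1 ∷
  0870_0865_0296_1 ∷ 0420_0871_0866_1 ∷ 0867_0865_0449_1 ∷ 0872_0441_0868_1 ∷ 0296_0869_0873_0 ∷
  0870_0429_0874_1 ∷ 0458_0871_0454_1 ∷ 0872_0875_0437_1 ∷ 0446_0441_0873_1 ∷ 0443_0460_0874_1 ∷
  0458_0875_0368_1 ∷ 0161_0877_0126_2 ∷ 0715_0877_0126_2 ∷ 0879_0880_0881_2 ∷ 0879_0882_0883_2 ∷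
  0884_0880_0438_1 ∷ 0885_0871_0881_1 ∷ 0886_0882_0457_1 ∷ 0885_0447_0883_1 ∷ 0884_0887_0888_1 ∷
  0885_0460_0889_1 ∷ 0886_0890_0891_1 ∷ 0892_0887_0296_1 ∷ 0893_0460_0888_1 ∷ 0446_0871_0889_1 ∷
  0890_0890_0296_1 ∷ 0458_0460_0891_1 ∷ 0892_0890_0457_1 ∷ 0893_0460_0894_1 ∷ 0895_0460_0894_1 ∷
  0895_0460_0368_1 ∷ 0897_0898_0728_0 ∷ 0897_0899_0900_0 ∷ 0901_0898_0542_0 ∷ 0902_0899_0296_0 ∷
  0554_0903_0900_1 ∷ 0901_0899_0904_0 ∷ 0902_0899_0566_0 ∷ 0296_0903_0552_1 ∷ 0554_0733_0904_0 ∷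
  0906_0907_0724_2 ∷ 0906_0200_0239_2 ∷ 0248_0907_0240_2 ∷ 0909_0910_0227_2 ∷ 0909_0911_0912_2 ∷
  0913_0910_0240_2 ∷ 0914_0911_0126_2 ∷ 0226_0199_0912_2 ∷ 0913_0710_0227_2 ∷ 0914_0710_0241_2 ∷
  0916_0917_0918_2 ∷ 0916_0740_0919_1 ∷ 0225_0917_0920_2 ∷ 0921_0253_0918_2 ∷ 0225_0249_0919_2 ∷
  0922_0247_0920_2 ∷ 0921_0249_0241_2 ∷ 0922_0247_0241_2 ∷ 0924_0925_0926_1 ∷ 0924_0927_0928_0 ∷
  0527_0925_0929_1 ∷ 0930_0531_0926_1 ∷ 0527_0927_0296_0 ∷ 0562_0931_0928_1 ∷ 0932_0531_0929_1 ∷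
  0930_0551_0540_1 ∷ 0527_0931_0540_1 ∷ 0932_0551_0553_1 ∷ 0265_0126_0126_1 ∷ 0935_0531_0936_1 ∷
  0935_0937_0938_1 ∷ 0939_0931_0936_1 ∷ 0296_0937_0940_1 ∷ 0939_0524_0938_1 ∷ 0939_0296_0928_0 ∷
  0527_0291_0940_1 ∷ 0599_0942_0943_2 ∷ 0599_0942_0605_2 ∷ 0944_0614_0943_2 ∷ 0944_0945_0612_2 ∷
  0603_0945_0600_2 ∷ 0947_0948_0949_1 ∷ 0947_0950_0951_1 ∷ 0952_0948_0953_1 ∷ 0954_0955_0949_1 ∷
  0801_0950_0296_0 ∷ 0801_0956_0951_1 ∷ 0952_0795_0957_1 ∷ 0958_0959_0953_1 ∷ 0954_0960_0807_1 ∷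
  0296_0955_0961_1 ∷ 0797_0956_0962_1 ∷ 0803_0369_0957_1 ∷ 0958_0351_0345_1 ∷ 0296_0959_0963_1 ∷
  0801_0960_0372_1 ∷ 0964_0296_0961_1 ∷ 0965_0296_0962_1 ∷ 0366_0296_0963_1 ∷ 0964_0351_0372_1 ∷
  0965_0809_0312_1 ∷ 0580_0967_0587_2 ∷ 0594_0967_0597_2 ∷ 0602_0969_0592_2 ∷ 0647_0969_0598_2 ∷
  0591_0126_0126_1 ∷ 0972_0973_0296_0 ∷ 0972_0809_0291_1 ∷ 0836_0973_0296_0 ∷ 0975_0976_0977_2 ∷
  0975_0615_0978_2 ∷ 0613_0976_0977_2 ∷ 0641_0601_0977_2 ∷ 0606_0979_0978_2 ∷ 0613_0979_0592_2 ∷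
  0981_0601_0982_2 ∷ 0981_0983_0984_2 ∷ 0985_0979_0982_2 ∷ 0126_0983_0986_2 ∷ 0985_0643_0984_2 ∷
  0985_0126_0978_2 ∷ 0613_0199_0986_2 ∷ 0663_0988_0841_0 ∷ 0663_0988_0457_0 ∷ 0150_0652_0160_2 ∷
  0991_0992_0406_2 ∷ 0991_0710_0406_2 ∷ 0991_0992_0165_2 ∷ 0126_0167_0152_1 ∷ 0296_0995_0445_0 ∷
  0296_0995_0675_0 ∷ 0997_0459_0296_1 ∷ 0997_0296_0998_1 ∷ 0296_0460_0998_0 ∷ 1000_1001_1002_1 ∷ []

prefixRows₄ : List ℕ
prefixRows₄ =
  1000_0429_1003_1 ∷ 0439_1001_1004_1 ∷ 0842_1005_1002_1 ∷ 0443_1006_1003_1 ∷ 1007_1008_1004_1 ∷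
  0296_1005_1009_0 ∷ 0458_1006_0440_1 ∷ 1007_0465_0368_1 ∷ 0296_1008_0680_0 ∷ 1010_0296_1009_1 ∷
  1010_0465_0457_1 ∷ 0127_1012_0134_2 ∷ 0141_1012_0144_2 ∷ 0153_1014_0162_2 ∷ 0715_1014_0162_2 ∷
  0453_1016_0296_1 ∷ 0895_1016_0296_1 ∷ 1018_1019_0695_2 ∷ 1018_0168_1020_2 ∷ 0166_1019_0695_2 ∷
  0174_0693_1020_2 ∷ 1022_0148_1023_2 ∷ 1022_0167_1024_2 ∷ 1025_0693_1023_2 ∷ 1025_0154_1024_2 ∷
  1025_0126_1020_2 ∷ 0209_0477_0724_2 ∷ 1028_1029_0904_1 ∷ 1028_0502_0541_1 ∷ 0550_1029_0542_1 ∷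
  1031_1032_0529_1 ∷ 1031_1033_1034_1 ∷ 1035_1032_0542_1 ∷ 1036_1033_0296_1 ∷ 0528_0291_1034_1 ∷
  1035_0890_0529_1 ∷ 1036_0890_0543_1 ∷ 0225_1038_0250_2 ∷ 0225_1038_0241_2 ∷ 1040_1041_1042_1 ∷
  1040_0927_1043_0 ∷ 0527_1041_1044_1 ∷ 1045_0555_1042_1 ∷ 0527_0551_1043_1 ∷ 1046_0549_1044_1 ∷
  1045_0551_0543_1 ∷ 1046_0549_0543_1 ∷ 0260_1048_0238_2 ∷ 0126_1048_0251_2 ∷ 0256_0229_0238_2 ∷
  0225_0126_0126_1 ∷ 0567_0296_0296_0 ∷ 1053_0215_0238_2 ∷ 1053_0199_0246_2 ∷ 0599_0586_0943_2 ∷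
  0801_1056_1057_1 ∷ 0801_1056_0336_1 ∷ 1058_0346_1057_1 ∷ 1058_1059_0808_1 ∷ 0803_1059_0312_1 ∷
  0126_1061_0605_2 ∷ 0126_1061_0771_2 ∷ 0126_0614_0126_1 ∷ 0599_1064_1065_2 ∷ 0599_1064_1066_2 ∷
  0944_1067_1065_2 ∷ 1068_0770_1066_2 ∷ 0126_1067_1069_2 ∷ 1068_0614_0157_2 ∷ 1070_0126_1069_2 ∷
  1070_0614_0600_2 ∷ 0787_1072_0793_1 ∷ 0799_1072_0350_1 ∷ 0126_0616_0126_1 ∷ 0802_1075_0332_1 ∷
  0836_1075_0329_1 ∷ 0797_0296_0296_0 ∷ 0774_0813_0126_1 ∷ 1079_1080_0644_2 ∷ 1079_0615_0986_2 ∷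
  0775_1080_0126_1 ∷ 1082_0640_0769_2 ∷ 1082_0615_0635_2 ∷ 1084_1085_1086_1 ∷ 1084_0809_1087_1 ∷
  0371_1085_1086_1 ∷ 0833_0308_1086_1 ∷ 0361_1088_1087_1 ∷ 0371_1088_0332_1 ∷ 0646_0126_0126_1 ∷
  1091_0308_1092_1 ∷ 1091_1093_1094_1 ∷ 1095_1088_1092_1 ∷ 0296_1093_1096_1 ∷ 1095_0365_1094_1 ∷
  1095_0296_1087_1 ∷ 0371_0291_1096_1 ∷ 0146_0652_0160_2 ∷ 0443_0843_0452_1 ∷ 1100_1101_0680_1 ∷
  1100_0890_0680_1 ∷ 1100_1101_0457_1 ∷ 0126_0126_0165_1 ∷ 0296_0459_0445_0 ∷ 0126_0172_0126_1 ∷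
  0166_0167_0126_2 ∷ 0150_1107_0160_2 ∷ 0150_1107_0401_2 ∷ 0420_1109_0427_1 ∷ 0434_1109_0437_1 ∷
  0126_0171_0126_1 ∷ 0446_1112_0454_1 ∷ 0895_1112_0454_1 ∷ 0408_0170_0165_2 ∷ 1115_0173_0147_2 ∷
  1115_0168_0711_2 ∷ 1117_1118_0873_1 ∷ 1117_0460_1119_1 ∷ 0458_1118_0873_1 ∷ 0466_0871_1119_1 ∷
  1121_0441_1122_1 ∷ 1121_0459_1123_1 ∷ 1124_0871_1122_1 ∷ 1124_0447_1123_1 ∷ 1124_0296_1119_1 ∷
  0511_0735_0904_1 ∷ 0252_1127_0264_2 ∷ 0266_1127_0126_2 ∷ 0922_0253_0240_2 ∷ 1130_0126_1131_1 ∷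
  1130_0126_0752_1 ∷ 0225_0247_1131_2 ∷ 0225_0249_0250_2 ∷ 0527_1134_0552_1 ∷ 0527_1134_0543_1 ∷
  0225_1136_1137_2 ∷ 0225_1136_0250_2 ∷ 0242_0253_1137_2 ∷ 0562_1139_0540_1 ∷ 0296_1139_0553_1 ∷
  0558_0531_0540_1 ∷ 0527_0296_0296_0 ∷ 1143_0517_0540_1 ∷ 1143_0291_0548_1 ∷ 0801_0792_1057_1 ∷
  0603_0945_0611_2 ∷ 0775_1147_0644_2 ∷ 0775_1147_0600_2 ∷ 0296_1149_0336_1 ∷ 0296_1149_0345_1 ∷
  0296_0346_0296_0 ∷ 0801_1152_1153_1 ∷ 0801_1152_1154_1 ∷ 1058_0353_1153_1 ∷ 0378_0369_1154_1 ∷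
  0606_1156_0592_2 ∷ 0157_1156_0592_2 ∷ 0296_0810_0296_0 ∷ 0610_0601_0592_2 ∷ 0965_0973_0296_0 ∷
  1161_1162_0372_1 ∷ 1161_0809_1096_1 ∷ 0366_1162_0296_0 ∷ 1164_0351_0962_1 ∷ 1164_0809_0830_1 ∷
  0613_0126_0126_1 ∷ 0375_0296_0296_0 ∷ 1168_0601_0592_2 ∷ 1168_0199_0637_2 ∷ 0439_0843_0452_1 ∷
  0166_0167_0165_2 ∷ 0296_0296_0457_0 ∷ 0296_0464_0296_0 ∷ 0458_0459_0296_1 ∷ 0164_0170_0165_2 ∷
  0443_1176_0452_1 ∷ 0443_1176_0675_1 ∷ 0174_1178_0162_2 ∷ 0157_1178_0162_2 ∷ 0296_0463_0296_0 ∷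
  0682_0462_0457_1 ∷ 1182_0465_0440_1 ∷ 1182_0460_0891_1 ∷ 1184_0148_0162_2 ∷ 1184_0126_0169_2 ∷
  0554_1186_0566_1 ∷ 0568_1186_0296_1 ∷ 0922_0247_0240_2 ∷ 1046_0555_0542_1 ∷ 1190_0296_1191_0 ∷
  1190_0296_0940_0 ∷ 0527_0549_1191_1 ∷ 0527_0551_0552_1 ∷ 0527_1194_1195_1 ∷ 0527_1194_0552_1 ∷
  0544_0555_1195_1 ∷ 0256_0215_0238_2 ∷ 0599_0945_0611_2 ∷ 0803_1059_0807_1 ∷ 0366_0342_0372_1 ∷
  0126_0617_0126_1 ∷ 0603_1202_0611_2 ∷ 0603_1202_0771_2 ∷ 0361_1204_0332_1 ∷ 0368_1204_0332_1 ∷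
  0613_0614_0600_2 ∷ 0357_0308_0332_1 ∷ 1208_0126_0644_2 ∷ 1208_0126_0986_2 ∷ 0613_0615_0600_2 ∷
  0371_0296_0296_0 ∷ 1212_0308_0332_1 ∷ 1212_0291_0341_1 ∷ 0458_0459_0457_1 ∷ 0456_0462_0457_1 ∷
  0150_1216_0163_2 ∷ 0150_1216_0157_2 ∷ 0466_1218_0454_1 ∷ 0368_1218_0454_1 ∷ 1220_0441_0454_1 ∷
  1220_0296_0461_1 ∷ 1046_0549_0542_1 ∷ 0225_0247_0241_2 ∷ 0558_0517_0540_1 ∷ 0801_1059_0807_1 ∷
  0296_0349_0296_0 ∷ 0803_1227_0807_1 ∷ 0803_1227_0345_1 ∷ 0371_0346_0312_1 ∷ 1230_0296_0372_1 ∷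
  1230_0296_1096_1 ∷ 0371_0809_0312_1 ∷ 0443_1233_0455_1 ∷ 0443_1233_0368_1 ∷ 0527_0549_0543_1 ∷
  0603_1236_0612_2 ∷ 0603_1236_0157_2 ∷ 0803_1238_0808_1 ∷ 0803_1238_0368_1 ∷ []

letterCode : ℕ → Maybe Letter
letterCode 0 = just zero
letterCode 1 = just (suc zero)
letterCode 2 = just (suc (suc zero))
letterCode _ = nothing

suffixRow : ℕ → SuffixRow
suffixRow n =
  row (address 8 (n / 100000000000)) (address 8 (n / 100000000 % 1000)) (address 8 (n / 100000 % 1000))
      (letterCode (n / 10000 % 10)) (address 11 (n % 10000))

prefixRow : ℕ → PrefixRow
prefixRow n =
  row (address 11 (n / 1000000000)) (address 11 (n / 100000 % 10000)) (address 11 (n / 10 % 10000))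
      (n % 10)

suffixTable : Tree SuffixRow 8
-- There are 228 rows for 256 addresses. The spare addresses copy the row of `root`, because
-- `consistent`, `twins` and `tracks` range over all addresses.
suffixTable = fromList 8 (suffixRow 001_002_003_3_0000) (map suffixRow suffixRows)

prefixTable : Tree PrefixRow 11
prefixTable = fromList 11 (prefixRow 0) (map prefixRow
  (prefixRows₀ ++ prefixRows₁ ++ prefixRows₂ ++ prefixRows₃ ++ prefixRows₄))

abstract
  -- Checking this definition evaluates `valid?` on the tables, explorations included. Being
  -- `abstract`, it is not evaluated again where it is used.
  valid : Automata.Valid suffixTable prefixTable
  valid = toWitness {a? = Automata.valid? suffixTable prefixTable} _

open Sorter suffixTable prefixTable using (machine)
open Solution suffixTable prefixTable valid using (timeBound; sorter-correct)

theorem4p7 : Σ[ M ∈ TuringMachine (Fin 3) ] Σ[ p ∈ Polynomial ]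
    ((s : TernaryString) → Σ[ is ∈ List ℕ ]
    (IsShortestSortingSequence s is ×
    (let open TuringMachine M in
    OnInput s Outputs encode is Within eval p (length s))))
theorem4p7 = machine , timeBound , sorter-correct
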